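{- Let $G$ be a finite group with subgroups $K_{\{0\}},K_{\{1\}},K_{\{2\}}$, and let $X=X(G,(K_{\{i\}})_{i\in\{0,1,2\}})$ be the coset complex. Assume that $G$ acts transitively on $X(2)$ (by left multiplication). For $i\in\{0,1,2\}$ let $R_i$ be the set of all relations $g_1g_2g_3=e$ with $g_1,g_2,g_3\in K_{\{i\}}\setminus\{e\}$. Assume $G=\langle\bigcup_iK_{\{i\}}\mid\bigcup_iR_i\rangle$ and let $\operatorname{Dehn}$ be the Dehn function of this presentation. Then: (1) for $N_0'=1+\max_{g\in G}\min\{l: g=g_1\cdots g_l,\ g_1,\dots,g_l\in\bigcup_iK_{\{i\}}\}$ it holds that $\operatorname{Exp}^0_b(X)\ge\frac{1}{3N_0'}$; (2) there is a universal polynomial $p(x,y)$, independent of $X$, such that $\operatorname{Exp}^1_b(X)\ge\frac{1}{3\,p(2N_0'+1,\operatorname{Dehn}(2N_0'+1))}$.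
   Context: Coset complex $X(G,(K_{\{i\}})_{i\in I})$: vertex set is the disjoint union of $S_i=\{gK_{\{i\}}:g\in G\}$; $gK_{\{i\}},g'K_{\{j\}}$ span an edge iff $i\ne j$ and $gK_{\{i\}}\cap g'K_{\{j\}}\ne\emptyset$; $X$ is the clique complex of this graph; $G$ acts by $h.gK_{\{i\}}=hgK_{\{i\}}$. Dehn function: for a presentation $\langle S\mid R\rangle$ ($S$ symmetric, $R\subseteq\operatorname{Free}(S)$), the area of a freely reduced word $w$ trivial in $G$ is the least $a$ such that $w=\prod_{l=1}^a u_l^{ -1}r_lu_l$ in $\operatorname{Free}(S)$ with $r_l\in R\cup R^{ -1}$, $u_l\in\operatorname{Free}(S)$; $\operatorname{Dehn}(m)=\max\{\operatorname{Area}(w): w=1\text{ in }G, |w|\le m\}$. Here $S=\bigcup_iK_{\{i\}}$. For a pure $n$-dimensional complex $X$ ($X(-1)=\{\emptyset\}$), over $\mathbb{F}_2$: $C^k$, $d_k\phi(\sigma)=\sum_{\tau\subset\sigma,|\tau|=|\sigma|-1}\phi(\tau)$, $B^k=\operatorname{Im}d_{k-1}$; $w(\tau)=\frac{|\{\sigma\in X(n):\tau\subseteq\sigma\}|}{\binom{n+1}{k+1}|X(n)|}$ for $\tau\in X(k)$, $w(\phi)=\sum_{\tau\in\operatorname{supp}\phi}w(\tau)$; $\operatorname{Exp}^k_b(X)=\min\{\frac{w(d_k\phi)}{\min_{\psi\in B^k}w(\phi+\psi)}:\phi\in C^k\setminus B^k\}$. -}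

module Defs where

open import Level using (0ℓ)
open import Algebra.Structures using (IsGroup)
open import Data.Bool.Base using (Bool; false; _xor_)
open import Data.Fin.Base using (Fin)
import Data.Fin.Properties as Fin
open import Data.Fin.Subset using (Subset; inside; outside; ⊥; _∈_; _⊆_; _∩_; ∣_∣; Nonempty)
open import Data.Fin.Subset.Properties using (_∈?_; _⊆?_; nonempty?; ∉⊥)
import Data.Bool.Properties as Bool
import Data.Integer.Base as ℤ
open import Data.List.Base as List
  using (List; []; _∷_; _++_; map; concat; concatMap; foldr; reverse; length; filter; filterᵇ; mapMaybe; allFin; deduplicate)
open import Data.List.Relation.Unary.All using (All)
open import Data.Maybe.Base using (Maybe; just; nothing)
open import Data.Nat.Base as ℕ using (ℕ; zero; suc)
import Data.Nat.Properties as ℕ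
open import Data.Nat.Combinatorics using (_C_)
open import Data.Product.Base using (Σ; ∃; ∃₂; _×_; _,_; proj₁; proj₂)
open import Data.Rational.Base as ℚ using (ℚ; 0ℚ)
open import Data.Sum.Base using (_⊎_)
open import Data.Vec.Base as Vec using (Vec; tabulate)
import Data.Vec.Properties as Vec
open import Function.Base using (flip; _∘_)
open import Function.Bundles using (_↔_; _⇔_; module Inverse)
open import Relation.Binary.Core using (Rel)
open import Relation.Binary.Construct.Closure.Equivalence using (EqClosure)
open import Relation.Binary.PropositionalEquality.Core using (_≡_; _≢_)
open import Relation.Nullary using (¬_; Dec; yes; no; does; contradiction)
open import Relation.Nullary.Decidable using (_×-dec_; _→-dec_; ¬?)
open import Relation.Unary using (Pred; Decidable)

------------------------------------------------------------------------
-- Minima and maxima of sets of numbers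

IsLeast : {A : Set} → Rel A 0ℓ → Pred A 0ℓ → Pred A 0ℓ
IsLeast _≤_ P m = P m × (∀ x → P x → m ≤ x)

IsGreatest : {A : Set} → Rel A 0ℓ → Pred A 0ℓ → Pred A 0ℓ
IsGreatest _≤_ = IsLeast (flip _≤_)

------------------------------------------------------------------------
-- Bivariate polynomials

-- The polynomial Σᵢ Σⱼ cᵢⱼ xⁱ yʲ is the list, indexed by i, of the lists,
-- indexed by j, of its coefficients cᵢⱼ; evaluation is by Horner's rule.
Poly : Set
Poly = List (List ℚ)

eval₁ : List ℚ → ℚ → ℚ
eval₁ cs y = foldr (λ c acc → c ℚ.+ y ℚ.* acc) 0ℚ cs

eval : Poly → ℚ → ℚ → ℚ
eval p x y = foldr (λ cs acc → eval₁ cs y ℚ.+ x ℚ.* acc) 0ℚ p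

fromℕ : ℕ → ℚ
fromℕ n = ℤ.+ n ℚ./ 1

------------------------------------------------------------------------
-- Simplicial complexes and coboundary expansion over 𝔽₂

record SimplicialComplex : Set₁ where
  field
    vertices : ℕ
    Simplex  : Pred (Subset vertices) 0ℓ
    simplex? : Decidable Simplex
    ∅-simplex : Simplex ⊥
    ⊆-closed  : ∀ {σ τ} → τ ⊆ σ → Simplex σ → Simplex τ

subsets : ∀ n → List (Subset n)
subsets zero    = Vec.[] ∷ []
subsets (suc n) = map (inside Vec.∷_) (subsets n) ++ map (outside Vec.∷_) (subsets n)

-- In a finite simplicial complex regarded as being of dimension n.
module Cohomology (X : SimplicialComplex) (n : ℕ) where
  open SimplicialComplex X

  IsFace : ℕ → Pred (Subset vertices) 0ℓ
  IsFace j σ = Simplex σ × ∣ σ ∣ ≡ j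

  isFace? : ∀ j → Decidable (IsFace j)
  isFace? j σ = simplex? σ ×-dec (∣ σ ∣ ℕ.≟ j)

  -- X(k) is Face (suc k): faces are indexed by their number of vertices, so
  -- that X(-1) = {∅} is Face 0.  The proof is irrelevant, so a face is
  -- determined by its set of vertices.
  record Face (j : ℕ) : Set where
    constructor face
    field
      support : Subset vertices
      .isFace : IsFace j support
  open Face public

  faces : ∀ j → List (Face j)
  faces j = mapMaybe toFace (subsets vertices)
    where
    toFace : Subset vertices → Maybe (Face j)
    toFace σ with isFace? j σ
    ... | yes p = just (face σ p)
    ... | no  _ = nothing

  -- Cᵏ is Cochain (suc k); 𝔽₂ is Bool with addition _xor_.
  Cochain : ℕ → Set
  Cochain j = Face j → Bool

  _+ᶜ_ : ∀ {j} → Cochain j → Cochain j → Cochain j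
  (φ +ᶜ ψ) σ = φ σ xor ψ σ

  d : ∀ {j} → Cochain j → Cochain (suc j)
  d {j} φ σ = foldr _xor_ false
    (map φ (filter (λ τ → support τ ⊆? support σ) (faces j)))

  IsCoboundary : ∀ {j} → Pred (Cochain (suc j)) 0ℓ
  IsCoboundary {j} φ = ∃ λ (ψ : Cochain j) → ∀ σ → φ σ ≡ d ψ σ

  -- The value at denominator 0 is a convention.  It is not used when X(n) is
  -- nonempty and j ≤ n + 1, where the denominator in `weight` is positive.
  ratio : ℕ → ℕ → ℚ
  ratio a zero    = 0ℚ
  ratio a (suc b) = ℤ.+ a ℚ./ suc b

  weight : ∀ {j} → Face j → ℚ
  weight {j} τ = ratio
    (length (filter (λ σ → support τ ⊆? support σ) (faces (suc n))))
    ((suc n C j) ℕ.* length (faces (suc n)))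

  ∥_∥ : ∀ {j} → Cochain j → ℚ
  ∥_∥ {j} φ = foldr ℚ._+_ 0ℚ (map weight (filterᵇ φ (faces j)))

  -- m is the minimum of w(φ + ψ) over coboundaries ψ.
  IsDistanceToB : ∀ {j} → Cochain (suc j) → ℚ → Set
  IsDistanceToB φ =
    IsLeast ℚ._≤_ (λ q → ∃ λ ψ → IsCoboundary ψ × q ≡ ∥ φ +ᶜ ψ ∥)

  -- e = Expᵏ_b(X).  When Cᵏ ∖ Bᵏ is empty there is no such e (the minimum over
  -- the empty set being +∞).
  IsExp : ℕ → Pred ℚ 0ℓ
  IsExp k = IsLeast ℚ._≤_ λ q →
    ∃ λ (φ : Cochain (suc k)) → ¬ IsCoboundary φ ×
    ∃ λ m → IsDistanceToB φ m ×
    Σ (ℚ.NonZero m) λ nz → q ≡ (∥ d φ ∥ ℚ.÷ m) {{nz}}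

------------------------------------------------------------------------
-- Finite groups and subgroups

record FiniteGroup : Set₁ where
  infixl 7 _∙_
  infix  8 _⁻¹
  field
    Carrier     : Set
    _∙_         : Carrier → Carrier → Carrier
    ε           : Carrier
    _⁻¹         : Carrier → Carrier
    isGroup     : IsGroup _≡_ _∙_ ε _⁻¹
    order       : ℕ
    enumeration : Fin order ↔ Carrier

  element : Fin order → Carrier
  element = Inverse.to enumeration

record Subgroup (G : FiniteGroup) : Set₁ where
  open FiniteGroup G
  field
    Member    : Pred Carrier 0ℓ
    member?   : Decidable Member
    ε-closed  : Member ε
    ∙-closed  : ∀ {g h} → Member g → Member h → Member (g ∙ h)
    ⁻¹-closed : ∀ {g} → Member g → Member (g ⁻¹)

------------------------------------------------------------------------
-- The coset complex

module CosetComplex (G : FiniteGroup) {r : ℕ} (K : Fin r → Subgroup G) where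
  open FiniteGroup G
  open Subgroup

  coset : Fin r → Carrier → Subset order
  coset i g = tabulate λ x → does (member? (K i) (g ⁻¹ ∙ element x))

  -- Tagging with i makes the union over i disjoint.
  Vertex : Set
  Vertex = Fin r × Subset order

  cosets : Fin r → List (Subset order)
  cosets i = deduplicate (Vec.≡-dec Bool._≟_) (map (coset i ∘ element) (allFin order))

  vertexList : List Vertex
  vertexList = concatMap (λ i → map (i ,_) (cosets i)) (allFin r)

  V : ℕ
  V = length vertexList

  vertex : Fin V → Vertex
  vertex = List.lookup vertexList

  Edge : Rel (Fin V) 0ℓ
  Edge u v = proj₁ (vertex u) ≢ proj₁ (vertex v)
           × Nonempty (proj₂ (vertex u) ∩ proj₂ (vertex v))

  edge? : ∀ u v → Dec (Edge u v)
  edge? u v = ¬? (proj₁ (vertex u) Fin.≟ proj₁ (vertex v))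
        ×-dec nonempty? (proj₂ (vertex u) ∩ proj₂ (vertex v))

  Clique : Pred (Subset V) 0ℓ
  Clique σ = ∀ u v → u ∈ σ → v ∈ σ → u ≢ v → Edge u v

  clique? : Decidable Clique
  clique? σ = Fin.all? λ u → Fin.all? λ v →
    (u ∈? σ) →-dec ((v ∈? σ) →-dec (¬? (u Fin.≟ v) →-dec edge? u v))

  complex : SimplicialComplex
  complex = record
    { vertices  = V
    ; Simplex   = Clique
    ; simplex?  = clique?
    ; ∅-simplex = λ u v u∈⊥ → contradiction u∈⊥ ∉⊥
    ; ⊆-closed  = λ τ⊆σ clique u v u∈τ v∈τ → clique u v (τ⊆σ u∈τ) (τ⊆σ v∈τ)
    }

  -- h . u = v, where h . gKᵢ = hgKᵢ.
  _·_↦_ : Carrier → Fin V → Fin V → Set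
  h · u ↦ v = ∃₂ λ i g → vertex u ≡ (i , coset i g) × vertex v ≡ (i , coset i (h ∙ g))

  _·ˢ_↦_ : Carrier → Subset V → Subset V → Set
  h ·ˢ σ ↦ τ = ∀ v → v ∈ τ ⇔ ∃ λ u → u ∈ σ × h · u ↦ v

  -- G acts transitively on the set X(k).
  TransitiveOn : ℕ → Set
  TransitiveOn k = ∀ (σ τ : Face (suc k)) → ∃ λ h → h ·ˢ support σ ↦ support τ
    where open Cohomology complex k

------------------------------------------------------------------------
-- Presentations and Dehn functions

-- S is a symmetric set of elements of G.  As usual for a symmetric generating
-- set, the formal inverse of a letter s is the letter s ⁻¹ ∈ S (so that s s is
-- freely trivial when s is an involution), and the identity element, if it
-- belongs to S, stands for the empty word and is not a letter.  This matters:
-- relators g₁g₂g₃ with all gᵢ ≠ ε never involve the letter ε, and cannot by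
-- themselves imply s s⁻¹ = ε, since they hold in ℤ/3 when every letter is 1.
module Presentation
  (G : FiniteGroup)
  (S : Pred (FiniteGroup.Carrier G) 0ℓ)
  (R : Pred (List (FiniteGroup.Carrier G)) 0ℓ)
  where
  open FiniteGroup G

  Word : Set
  Word = List Carrier

  value : Word → Carrier
  value = foldr _∙_ ε

  Letter : Pred Carrier 0ℓ
  Letter s = S s × s ≢ ε

  IsWord : Pred Word 0ℓ
  IsWord = All Letter

  data _⟶_ : Rel Word 0ℓ where
    cancel : ∀ u {s} v → Letter s → (u ++ s ∷ s ⁻¹ ∷ v) ⟶ (u ++ v)

  -- Equality in Free(S).
  _∼_ : Rel Word 0ℓ
  _∼_ = EqClosure _⟶_

  Reduced : Pred Word 0ℓ
  Reduced w = ∀ w′ → ¬ (w ⟶ w′)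

  inverse : Word → Word
  inverse w = reverse (map _⁻¹ w)

  record Conjugate : Set where
    field
      u r      : Word
      u-isWord : IsWord u
      r∈R±     : R r ⊎ (∃ λ r′ → R r′ × r ≡ inverse r′)

    conjugate : Word
    conjugate = inverse u ++ r ++ u

  -- In Free(S), w is a product of a conjugates of elements of R ∪ R⁻¹.
  FilledBy : Word → ℕ → Set
  FilledBy w a = ∃ λ (cs : Vec Conjugate a) →
    w ∼ concat (map Conjugate.conjugate (Vec.toList cs))

  -- G = ⟨ S ∣ R ⟩: the canonical map Free(S) → G is onto, and its kernel is the
  -- normal closure of R.
  Presents : Set
  Presents = (∀ g → ∃ λ w → IsWord w × value w ≡ g)
           × (∀ w → IsWord w → value w ≡ ε ⇔ ∃ (FilledBy w))

  IsArea : Word → ℕ → Set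
  IsArea w = IsLeast ℕ._≤_ (FilledBy w)

  IsDehn : (ℕ → ℕ) → Set
  IsDehn D = ∀ m → IsGreatest ℕ._≤_
    (λ a → ∃ λ w → IsWord w × Reduced w × value w ≡ ε × length w ℕ.≤ m × IsArea w a)
    (D m)

module SubgroupPresentation (G : FiniteGroup) {r : ℕ} (K : Fin r → Subgroup G) where
  open FiniteGroup G
  open Subgroup

  ⋃K : Pred Carrier 0ℓ
  ⋃K g = ∃ λ i → Member (K i) g

  ⋃R : Pred (List Carrier) 0ℓ
  ⋃R w = ∃ λ i → ∃ λ g₁ → ∃ λ g₂ → ∃ λ g₃ →
      (Member (K i) g₁ × g₁ ≢ ε)
    × (Member (K i) g₂ × g₂ ≢ ε)
    × (Member (K i) g₃ × g₃ ≢ ε)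
    × g₁ ∙ g₂ ∙ g₃ ≡ ε
    × w ≡ g₁ ∷ g₂ ∷ g₃ ∷ []

  open Presentation G ⋃K ⋃R public

  -- l is the least length of an expression of g as a product of elements of ⋃K.
  IsLength : Carrier → ℕ → Set
  IsLength g = IsLeast ℕ._≤_ (λ l → ∃ λ w → All ⋃K w × value w ≡ g × length w ≡ l)

  IsMaxLength : ℕ → Set
  IsMaxLength = IsGreatest ℕ._≤_ (λ l → ∃ λ g → IsLength g l)

{-# OPTIONS --safe #-}
-- A cochain φ is compared with coboundaries obtained by coning from K₀: on vertices, with the
-- constant φ(K₀); on edges, with the coboundary of the vertex cochain that sums φ along a path
-- from K₀ to each vertex, spelled by a word in ⋃K.  The error at a face is then the sum of dφ
-- over a filling: a path in the first case, a set of triangles in the second.  Translating the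
-- cones by g ∈ G and averaging over g spreads every filling evenly over X, because G is
-- transitive on triangles; hence the distance from φ to the coboundaries is at most a constant
-- times the size of the filling times ∥ dφ ∥.
--
-- On edges, a cone together with its base edge is a loop spelling a trivial word of length at
-- most 2N₀′ + 1, which in Free(S) is a product of at most Dehn(2N₀′ + 1) conjugates of relators.
-- Mod 2 the conjugating paths cancel, so only the relators count; each is filled by 6 triangles.
module Submission where

open import Defs
open import Algebra.Bundles using (Group; CommutativeRing)
import Algebra.Properties.CommutativeSemigroup
import Algebra.Properties.Group
open import Data.Bool.Base using (Bool; true; false; not; _xor_; if_then_else_)
import Data.Bool.Properties as Bool
open import Data.Bool.Solver using (module xor-∧-Solver)
open import Data.Fin.Base using (Fin; zero; suc)
import Data.Fin.Properties as Fin
open import Data.Fin.Subset using (Subset; inside; outside; ⊥; ⊤; ⁅_⁆; _∪_; _⊆_; ∣_∣)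
  renaming (_∈_ to _∈ˢ_; _∉_ to _∉ˢ_)
open import Data.Fin.Subset.Properties
  using (_⊆?_; nonempty?; ∉⊥; ∈⊤; ∣⊥∣≡0; ∣⊤∣≡n; ∣⁅x⁆∣≡1; ⊆-antisym; x∈⁅x⁆; x∈⁅y⁆⇒x≡y; x∈p∪q⁻; x∈p∩q⁺)
import Data.Integer.Base as ℤ
import Data.Integer.Properties as ℤ
open import Data.List.Base as List
  using (List; []; _∷_; _++_; [_]; map; filter; filterᵇ; length; foldr; catMaybes;
         concat; concatMap; reverse; allFin)
open import Data.List.Membership.Propositional using (_∈_)
open import Data.List.Membership.Propositional.Properties
open import Data.List.Membership.Propositional.Properties.WithK using (unique∧set⇒bag)
import Data.List.Properties as List
open import Data.List.Relation.Binary.BagAndSetEquality using (∼bag⇒↭)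
open import Data.List.Relation.Binary.Permutation.Propositional using (_↭_; ↭⇒↭ₛ)
import Data.List.Relation.Binary.Permutation.Propositional.Properties as ↭
import Data.List.Relation.Binary.Permutation.Setoid.Properties as ↭ₛ
open import Data.List.Relation.Unary.All as All using (All; []; _∷_)
import Data.List.Relation.Unary.All.Properties as All
open import Data.List.Relation.Unary.AllPairs as AllPairs using ([]; _∷_)
import Data.List.Relation.Unary.AllPairs.Properties as AllPairs
open import Data.List.Relation.Unary.Any as Any using (here; there)
import Data.List.Relation.Unary.Any.Properties as Any
open import Data.List.Relation.Unary.Unique.Propositional using (Unique)
import Data.List.Relation.Unary.Unique.DecPropositional.Properties as Dedup
import Data.List.Relation.Unary.Unique.Propositional.Properties as Unique
open import Data.Maybe.Base using (Maybe)
open import Data.Nat.Base as ℕ using (ℕ; zero; suc; _+_; _*_; z≤n; s≤s)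
open import Data.Nat.Induction using (<-rec)
open import Data.Nat.ListAction using (sum)
open import Data.Nat.ListAction.Properties using (sum-↭)
import Data.Nat.Properties as ℕ
open import Data.Nat.Solver using (module +-*-Solver)
open import Data.Nat.Combinatorics using (_C_)
open import Data.Product.Base using (Σ; ∃; _×_; _,_; proj₁; proj₂)
open import Data.Rational.Base as ℚ using (ℚ; _≤_; _/_; 1/_; 0ℚ; 1ℚ)
import Data.Rational.Properties as ℚ
open import Data.Rational.Properties using (pos⇒nonZero)
import Data.Rational.Unnormalised.Base as ℚᵘ
import Data.Rational.Unnormalised.Properties as ℚᵘ
open import Data.Sum.Base using (_⊎_; inj₁; inj₂)
open import Data.Unit.Base as Unit using (tt)
open import Data.Vec.Base as Vec using (_[_]≔_; here; there)
import Data.Vec.Properties as Vec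
open import Function.Base using (_∘_; id)
open import Function.Bundles using (mk⇔; module Equivalence; module Inverse)
open import Level using (0ℓ)
open import Relation.Binary.Construct.Closure.Equivalence using (gfold)
import Relation.Binary.Construct.Closure.ReflexiveTransitive as Star
open import Relation.Binary.Construct.Closure.Symmetric using (fwd)
open import Relation.Binary.PropositionalEquality hiding ([_])
open import Relation.Nullary using (Dec; yes; no; ¬_; contradiction; does)
open import Relation.Nullary.Decidable
  using (recompute; does-⇔; dec-true; dec-false; from-yes; _→-dec_; ¬?; decidable-stable)
open import Relation.Unary using (Pred; Decidable)

-- Transitivity makes every triangle a translate `F g chamber`, so a cochain becomes, for each set
-- of types, a Boolean function of `g`. No filling is built as a subcomplex: its cost is `μ`, the
-- number of `g` at which a sum over 𝔽₂ is odd. `μ` is subadditive under `xor` and invariant under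
-- right translation, so a triangle costs the same wherever it sits. The obstacle on edges is that a
-- letter may lie in several subgroups, whereas a path must run through one definite coset. `choice`
-- fixes a type for each letter; moving a letter to another type that contains it costs two
-- triangles. Hence 6 for the three letters of a relator, and 5 for a cone: one triangle at the base
-- edge, and two for each of the two letters joining the base to the chosen representatives. Short
-- words, reduced forms and areas are obtained only under double negation; this suffices because the
-- conclusions are decidable inequalities.

private variable
  m n : ℕ
  A B : Set

open Algebra.Properties.CommutativeSemigroup ℕ.+-commutativeSemigroup using ()
  renaming (interchange to +-interchange)

-- Finite sums and indicator functions

unique∧set⇒↭ : {xs ys : List A} → Unique xs → Unique ys →
               (∀ {x} → x ∈ xs → x ∈ ys) → (∀ {x} → x ∈ ys → x ∈ xs) → xs ↭ ys
unique∧set⇒↭ xs! ys! to from = ∼bag⇒↭ (unique∧set⇒bag xs! ys! (mk⇔ to from))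

∑ : List A → (A → ℕ) → ℕ
∑ xs h = sum (map h xs)

∑-cong∈ : (xs : List A) {h k : A → ℕ} → (∀ {x} → x ∈ xs → h x ≡ k x) → ∑ xs h ≡ ∑ xs k
∑-cong∈ []       h≡k = refl
∑-cong∈ (x ∷ xs) h≡k = cong₂ _+_ (h≡k (here refl)) (∑-cong∈ xs (λ x∈xs → h≡k (there x∈xs)))

∑-cong : (xs : List A) {h k : A → ℕ} → (∀ x → h x ≡ k x) → ∑ xs h ≡ ∑ xs k
∑-cong xs h≡k = ∑-cong∈ xs (λ {x} _ → h≡k x)

∑-mono-All : {xs : List A} {h k : A → ℕ} → All (λ x → h x ℕ.≤ k x) xs → ∑ xs h ℕ.≤ ∑ xs k
∑-mono-All []       = z≤n
∑-mono-All (p ∷ ps) = ℕ.+-mono-≤ p (∑-mono-All ps)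

∑-mono : (xs : List A) {h k : A → ℕ} → (∀ x → h x ℕ.≤ k x) → ∑ xs h ℕ.≤ ∑ xs k
∑-mono []       h≤k = z≤n
∑-mono (x ∷ xs) h≤k = ℕ.+-mono-≤ (h≤k x) (∑-mono xs h≤k)

∑-zero : (xs : List A) → ∑ xs (λ _ → 0) ≡ 0
∑-zero []       = refl
∑-zero (x ∷ xs) = ∑-zero xs

∑-const : (xs : List A) (c : ℕ) → ∑ xs (λ _ → c) ≡ length xs * c
∑-const []       c = refl
∑-const (x ∷ xs) c = cong (c +_) (∑-const xs c)

∑-+ : (xs : List A) (h k : A → ℕ) → ∑ xs (λ x → h x + k x) ≡ ∑ xs h + ∑ xs k
∑-+ []       h k = refl
∑-+ (x ∷ xs) h k = trans (cong (h x + k x +_) (∑-+ xs h k)) (+-interchange (h x) (k x) _ _)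

∑-* : (xs : List A) (c : ℕ) (h : A → ℕ) → ∑ xs (λ x → c * h x) ≡ c * ∑ xs h
∑-* []       c h = sym (ℕ.*-zeroʳ c)
∑-* (x ∷ xs) c h = trans (cong (c * h x +_) (∑-* xs c h)) (sym (ℕ.*-distribˡ-+ c (h x) _))

∑-swap : (xs : List A) (ys : List B) (h : A → B → ℕ) →
         ∑ xs (λ x → ∑ ys (h x)) ≡ ∑ ys (λ y → ∑ xs (λ x → h x y))
∑-swap []       ys h = sym (∑-zero ys)
∑-swap (x ∷ xs) ys h = trans (cong (∑ ys (h x) +_) (∑-swap xs ys h))
                             (sym (∑-+ ys (h x) (λ y → ∑ xs (λ x → h x y))))

∑-↭ : {xs ys : List A} (h : A → ℕ) → xs ↭ ys → ∑ xs h ≡ ∑ ys h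
∑-↭ h p = sum-↭ (↭.map⁺ h p)

∈⇒≤∑ : {x : A} {xs : List A} (h : A → ℕ) → x ∈ xs → h x ℕ.≤ ∑ xs h
∈⇒≤∑ h (here refl)  = ℕ.m≤m+n _ _
∈⇒≤∑ h (there x∈xs) = ℕ.≤-trans (∈⇒≤∑ h x∈xs) (ℕ.m≤n+m _ _)

⟦_⟧ : Bool → ℕ
⟦ true  ⟧ = 1
⟦ false ⟧ = 0

⟦xor⟧≤ : ∀ a b → ⟦ a xor b ⟧ ℕ.≤ ⟦ a ⟧ + ⟦ b ⟧
⟦xor⟧≤ true  true  = z≤n
⟦xor⟧≤ true  false = s≤s z≤n
⟦xor⟧≤ false b     = ℕ.≤-refl

⟦does⟧-yes : {P : Set} (P? : Dec P) → P → ⟦ does P? ⟧ ≡ 1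
⟦does⟧-yes P? p = cong ⟦_⟧ (dec-true P? p)

⟦does⟧-no : {P : Set} (P? : Dec P) → ¬ P → ⟦ does P? ⟧ ≡ 0
⟦does⟧-no P? ¬p = cong ⟦_⟧ (dec-false P? ¬p)

length-filter : {P : Pred A 0ℓ} (P? : Decidable P) (xs : List A) →
                length (filter P? xs) ≡ ∑ xs (λ x → ⟦ does (P? x) ⟧)
length-filter P? []       = refl
length-filter P? (x ∷ xs) with P? x
... | yes _ = cong suc (length-filter P? xs)
... | no  _ = length-filter P? xs

∑-filter : {P : Pred A 0ℓ} (P? : Decidable P) (xs : List A) (h : A → ℕ) →
           ∑ (filter P? xs) h ≡ ∑ xs (λ x → ⟦ does (P? x) ⟧ * h x)
∑-filter P? []       h = refl
∑-filter P? (x ∷ xs) h with P? x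
... | yes _ = cong₂ _+_ (sym (ℕ.+-identityʳ (h x))) (∑-filter P? xs h)
... | no  _ = ∑-filter P? xs h

∑-filterᵇ : (φ : A → Bool) (xs : List A) (h : A → ℕ) →
            ∑ (filterᵇ φ xs) h ≡ ∑ xs (λ x → ⟦ φ x ⟧ * h x)
∑-filterᵇ φ []       h = refl
∑-filterᵇ φ (x ∷ xs) h with φ x
... | true  = cong₂ _+_ (sym (ℕ.+-identityʳ (h x))) (∑-filterᵇ φ xs h)
... | false = ∑-filterᵇ φ xs h

∑-indicator : {P : Pred A 0ℓ} (P? : Decidable P) (h : A → ℕ) {y : A} {xs : List A} →
              Unique xs → y ∈ xs → P y → (∀ {x} → P x → x ≡ y) →
              ∑ xs (λ x → ⟦ does (P? x) ⟧ * h x) ≡ h y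
∑-indicator P? h {y} {x ∷ xs} (x∉xs ∷ _) (here refl) Py P⇒≡y =
  trans (cong₂ (λ m n → m * h x + n) (⟦does⟧-yes (P? x) Py) rest)
        (trans (ℕ.+-identityʳ _) (ℕ.+-identityʳ _))
  where
  rest : ∑ xs (λ x → ⟦ does (P? x) ⟧ * h x) ≡ 0
  rest = trans (∑-cong∈ xs λ {z} z∈xs → cong (_* h z)
                  (⟦does⟧-no (P? z) (λ Pz → All.lookup x∉xs z∈xs (sym (P⇒≡y Pz)))))
               (∑-zero xs)
∑-indicator P? h {y} {x ∷ xs} (x∉xs ∷ xs!) (there y∈xs) Py P⇒≡y =
  cong₂ (λ m n → m * h x + n)
    (⟦does⟧-no (P? x) (λ Px → All.lookup x∉xs y∈xs (P⇒≡y Px)))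
    (∑-indicator P? h xs! y∈xs Py P⇒≡y)

-- Enumeration, images and preimages of finite subsets

subsets-complete : (σ : Subset n) → σ ∈ subsets n
subsets-complete Vec.[]              = here refl
subsets-complete (inside  Vec.∷ σ) = ∈-++⁺ˡ (∈-map⁺ _ (subsets-complete σ))
subsets-complete (outside Vec.∷ σ) = ∈-++⁺ʳ _ (∈-map⁺ _ (subsets-complete σ))

subsets-unique : ∀ n → Unique (subsets n)
subsets-unique zero    = [] ∷ []
subsets-unique (suc n) = Unique.++⁺ (Unique.map⁺ Vec.∷-injectiveʳ (subsets-unique n))
                                    (Unique.map⁺ Vec.∷-injectiveʳ (subsets-unique n)) disjoint
  where
  disjoint : ∀ {σ} → σ ∈ map (inside Vec.∷_) (subsets n) × σ ∈ map (outside Vec.∷_) (subsets n) → _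
  disjoint (p , q) with ∈-map⁻ _ p | ∈-map⁻ _ q
  ... | _ , _ , refl | _ , _ , ()

image : (Fin n → Fin m) → Subset n → Subset m
image f Vec.[]            = ⊥
image f (inside  Vec.∷ A) = image (f ∘ suc) A [ f zero ]≔ inside
image f (outside Vec.∷ A) = image (f ∘ suc) A

∈-image⁺ : (f : Fin n → Fin m) {i : Fin n} {A : Subset n} → i ∈ˢ A → f i ∈ˢ image f A
∈-image⁺ f {zero} {inside Vec.∷ A} here = Vec.[]≔-updates _ (f zero)
∈-image⁺ f {suc i} {outside Vec.∷ A} (there i∈A) = ∈-image⁺ (f ∘ suc) i∈A
∈-image⁺ f {suc i} {inside Vec.∷ A} (there i∈A) with f (suc i) Fin.≟ f zero
... | yes eq = subst (_∈ˢ image f (inside Vec.∷ A)) (sym eq) (Vec.[]≔-updates _ (f zero))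
... | no neq = Vec.[]≔-minimal _ (f (suc i)) (f zero) neq (∈-image⁺ (f ∘ suc) i∈A)

∈-image⁻ : (f : Fin n → Fin m) (A : Subset n) {v : Fin m} → v ∈ˢ image f A → ∃ λ i → i ∈ˢ A × f i ≡ v
∈-image⁻ f Vec.[] v∈ = contradiction v∈ ∉⊥
∈-image⁻ f (outside Vec.∷ A) v∈ with ∈-image⁻ (f ∘ suc) A v∈
... | i , i∈A , eq = suc i , there i∈A , eq
∈-image⁻ f (inside Vec.∷ A) {v} v∈ with v Fin.≟ f zero
... | yes eq = zero , here , sym eq
... | no neq with ∈-image⁻ (f ∘ suc) A
      (Vec.lookup⇒[]= v _ (trans (sym (Vec.lookup∘update′ neq (image (f ∘ suc) A) inside)) (Vec.[]=⇒lookup v∈)))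
... | i , i∈A , eq = suc i , there i∈A , eq

∣add∣ : (σ : Subset n) (v : Fin n) → v ∉ˢ σ → ∣ σ [ v ]≔ inside ∣ ≡ suc ∣ σ ∣
∣add∣ (inside  Vec.∷ σ) zero    v∉σ = contradiction here v∉σ
∣add∣ (outside Vec.∷ σ) zero    v∉σ = refl
∣add∣ (inside  Vec.∷ σ) (suc v) v∉σ = cong suc (∣add∣ σ v (v∉σ ∘ there))
∣add∣ (outside Vec.∷ σ) (suc v) v∉σ = ∣add∣ σ v (v∉σ ∘ there)

∣image∣ : (f : Fin n → Fin m) → (∀ {i j} → f i ≡ f j → i ≡ j) → (A : Subset n) → ∣ image f A ∣ ≡ ∣ A ∣
∣image∣ {m = m} f f-inj Vec.[] = ∣⊥∣≡0 m
∣image∣ f f-inj (outside Vec.∷ A) = ∣image∣ (f ∘ suc) (Fin.suc-injective ∘ f-inj) A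
∣image∣ f f-inj (inside Vec.∷ A) =
  trans (∣add∣ _ (f zero) f0∉) (cong suc (∣image∣ (f ∘ suc) (Fin.suc-injective ∘ f-inj) A))
  where
  f0∉ : f zero ∉ˢ image (f ∘ suc) A
  f0∉ f0∈ with ∈-image⁻ (f ∘ suc) A f0∈
  ... | i , _ , eq = Fin.0≢1+n (f-inj (sym eq))

image-cong : {f g : Fin n → Fin m} {A : Subset n} → (∀ {i} → i ∈ˢ A → f i ≡ g i) → image f A ≡ image g A
image-cong {f = f} {g} {A} f≡g = ⊆-antisym (half f g f≡g) (half g f (sym ∘ f≡g))
  where
  half : ∀ f g → (∀ {i} → i ∈ˢ A → f i ≡ g i) → image f A ⊆ image g A
  half f g f≡g v∈ with ∈-image⁻ f A v∈
  ... | i , i∈A , refl = subst (_∈ˢ image g A) (sym (f≡g i∈A)) (∈-image⁺ g i∈A)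

preimage : (Fin n → Fin m) → Subset m → Subset n
preimage f σ = Vec.tabulate (Vec.lookup σ ∘ f)

∈-preimage⁺ : (f : Fin n → Fin m) (σ : Subset m) {i : Fin n} → f i ∈ˢ σ → i ∈ˢ preimage f σ
∈-preimage⁺ f σ {i} p = Vec.lookup⇒[]= i _ (trans (Vec.lookup∘tabulate _ i) (Vec.[]=⇒lookup p))

∈-preimage⁻ : (f : Fin n → Fin m) (σ : Subset m) {i : Fin n} → i ∈ˢ preimage f σ → f i ∈ˢ σ
∈-preimage⁻ f σ {i} p = Vec.lookup⇒[]= (f i) σ (trans (sym (Vec.lookup∘tabulate _ i)) (Vec.[]=⇒lookup p))

image-preimage : (f : Fin n → Fin m) {σ : Subset m} {A : Subset n} → σ ⊆ image f A → image f (preimage f σ) ≡ σ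
image-preimage f {σ} {A} σ⊆ = ⊆-antisym to from
  where
  to : image f (preimage f σ) ⊆ σ
  to v∈ with ∈-image⁻ f (preimage f σ) v∈
  ... | i , i∈ , refl = ∈-preimage⁻ f σ i∈
  from : σ ⊆ image f (preimage f σ)
  from v∈ with ∈-image⁻ f A (σ⊆ v∈)
  ... | i , _ , refl = ∈-image⁺ f (∈-preimage⁺ f σ v∈)

-- Faces of a complex, and embeddings of the standard simplex

module Faces (X : SimplicialComplex) (n : ℕ) where
  open SimplicialComplex X
  open Cohomology X n

  support-injective : ∀ {j} {σ τ : Face j} → support σ ≡ support τ → σ ≡ τ
  support-injective refl = refl

  isFaceOf : ∀ {j} (σ : Face j) → IsFace j (support σ)
  isFaceOf {j} (face σ p) = recompute (isFace? j σ) p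

  private
    -- The function mapped over the subsets is local to `faces`; unification against `refl` recovers
    -- it.
    faces-as-mapMaybe : ∀ j → Σ (Subset vertices → Maybe (Face j)) λ f →
                        faces j ≡ catMaybes (map f (subsets vertices))
    faces-as-mapMaybe j = _ , refl

  toFace : ∀ j → Subset vertices → Maybe (Face j)
  toFace j = proj₁ (faces-as-mapMaybe j)

  map-support-faces : ∀ j → map support (faces j) ≡ filter (isFace? j) (subsets vertices)
  map-support-faces j = go (subsets vertices)
    where
    go : ∀ xs → map support (catMaybes (map (toFace j) xs)) ≡ filter (isFace? j) xs
    go []       = refl
    go (σ ∷ xs) with isFace? j σ
    ... | yes p = trans (cong (σ ∷_) (go xs)) (sym (List.filter-accept (isFace? j) p))
    ... | no ¬p = trans (go xs) (sym (List.filter-reject (isFace? j) ¬p))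

  faces-unique : ∀ j → Unique (faces j)
  faces-unique j = Unique.map⁻ (subst Unique (sym (map-support-faces j))
                     (Unique.filter⁺ (isFace? j) (subsets-unique vertices)))

  faces-complete : ∀ {j} (σ : Face j) → σ ∈ faces j
  faces-complete {j} σ with ∈-map⁻ support (subst (support σ ∈_) (sym (map-support-faces j))
                             (∈-filter⁺ (isFace? j) (subsets-complete (support σ)) (isFaceOf σ)))
  ... | τ , τ∈ , eq = subst (_∈ faces j) (support-injective (sym eq)) τ∈

  below : ∀ {j k} → Face k → List (Face j)
  below {j} σ = filter (λ τ → support τ ⊆? support σ) (faces j)

xor-↭ : {xs ys : List Bool} → xs ↭ ys → foldr _xor_ false xs ≡ foldr _xor_ false ys
xor-↭ p = ↭ₛ.foldr-commMonoid (setoid Bool) (CommutativeRing.+-isCommutativeMonoid Bool.xor-∧-commutativeRing) (↭⇒↭ₛ p)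

-- Model of a single chamber. For a concrete number of vertices its faces form a closed list, so
-- coboundaries on it evaluate by computation.
standardSimplex : ℕ → SimplicialComplex
standardSimplex n = record
  { vertices  = n
  ; Simplex   = λ _ → Unit.⊤
  ; simplex?  = λ _ → yes tt
  ; ∅-simplex = tt
  ; ⊆-closed  = λ _ _ → tt
  }

module Embedding (X : SimplicialComplex) (n r : ℕ) where
  open SimplicialComplex X
  open Cohomology X n
  open Faces X n
  module Δ where
    open Cohomology (standardSimplex r) n public
    open Faces (standardSimplex r) n public

  module _ (f : Fin r → Fin vertices) (f-injective : ∀ {i j} → f i ≡ f j → i ≡ j)
           (f-simplex : Simplex (image f ⊤)) where

    embed : ∀ {j} → Δ.Face j → Face j
    embed {j} (Δ.face A p) = face (image f A)
      ( ⊆-closed image⊆ f-simplex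
      , trans (∣image∣ f f-injective A) (proj₂ p))
      where
      image⊆ : image f A ⊆ image f ⊤
      image⊆ v∈ with ∈-image⁻ f A v∈
      ... | _ , _ , refl = ∈-image⁺ f ∈⊤

    ∈-support-embed⁻ : ∀ {j} (A : Δ.Face j) {i} → f i ∈ˢ support (embed A) → i ∈ˢ Δ.support A
    ∈-support-embed⁻ A fi∈ with ∈-image⁻ f (Δ.support A) fi∈
    ... | i′ , i′∈A , eq = subst (_∈ˢ Δ.support A) (f-injective eq) i′∈A

    embed-⊆ : ∀ {j k} {A : Δ.Face j} {B : Δ.Face k} → Δ.support A ⊆ Δ.support B →
              support (embed A) ⊆ support (embed B)
    embed-⊆ {A = A} A⊆B v∈ with ∈-image⁻ f (Δ.support A) v∈
    ... | i , i∈A , refl = ∈-image⁺ f (A⊆B i∈A)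

    embed-⊆⁻ : ∀ {j k} {A : Δ.Face j} {B : Δ.Face k} → support (embed A) ⊆ support (embed B) →
              Δ.support A ⊆ Δ.support B
    embed-⊆⁻ {B = B} ⊆ i∈A = ∈-support-embed⁻ B (⊆ (∈-image⁺ f i∈A))

    embed-injective : ∀ {j} {A B : Δ.Face j} → embed A ≡ embed B → A ≡ B
    embed-injective {A = A} {B} eq = Δ.support-injective
      (⊆-antisym (embed-⊆⁻ {A = A} {B} (subst (support (embed A) ⊆_) (cong support eq) id))
                 (embed-⊆⁻ {A = B} {A} (subst (_⊆ support (embed A)) (cong support eq) id)))

    embed-onto : ∀ {j k} (τ : Face j) (A : Δ.Face k) → support τ ⊆ support (embed A) →
                 ∃ λ (B : Δ.Face j) → Δ.support B ⊆ Δ.support A × embed B ≡ τ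
    embed-onto τ A τ⊆ = B′ , B⊆A , support-injective image≡
      where
      image≡ : image f (preimage f (support τ)) ≡ support τ
      image≡ = image-preimage f {A = Δ.support A} τ⊆
      B′ : Δ.Face _
      B′ = Δ.face (preimage f (support τ))
            (tt , trans (sym (∣image∣ f f-injective (preimage f (support τ))))
                        (trans (cong ∣_∣ image≡) (proj₂ (isFaceOf τ))))
      B⊆A : preimage f (support τ) ⊆ Δ.support A
      B⊆A i∈ = ∈-support-embed⁻ A (τ⊆ (∈-preimage⁻ f (support τ) i∈))

    -- Injectivity of `f` makes the embedding a bijection from the faces of `A` to those of its
    -- image. Coboundaries and sums over faces can therefore be computed on the standard simplex.
    below-embed : ∀ {j k} (A : Δ.Face k) → below {j} (embed A) ↭ map embed (Δ.below A)
    below-embed {j} A = unique∧set⇒↭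
      (Unique.filter⁺ _ (faces-unique j))
      (Unique.map⁺ embed-injective (Unique.filter⁺ _ (Δ.faces-unique j)))
      to from
      where
      to : ∀ {τ} → τ ∈ below (embed A) → τ ∈ map embed (Δ.below A)
      to {τ} τ∈ with embed-onto τ A (proj₂ (∈-filter⁻ (λ τ → support τ ⊆? support (embed A)) {xs = faces j} τ∈))
      ... | B , B⊆A , refl = ∈-map⁺ embed (∈-filter⁺ (λ B → Δ.support B ⊆? Δ.support A) (Δ.faces-complete B) B⊆A)
      from : ∀ {τ} → τ ∈ map embed (Δ.below A) → τ ∈ below (embed A)
      from τ∈ with ∈-map⁻ embed τ∈
      ... | B , B∈ , refl = ∈-filter⁺ (λ τ → support τ ⊆? support (embed A)) (faces-complete (embed B))
              (embed-⊆ {A = B} {A} (proj₂ (∈-filter⁻ (λ B → Δ.support B ⊆? Δ.support A) {xs = Δ.faces j} B∈)))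

    d-embed : ∀ {j} (φ : Cochain j) (A : Δ.Face (suc j)) → d φ (embed A) ≡ Δ.d (φ ∘ embed) A
    d-embed φ A = trans (xor-↭ (↭.map⁺ φ (below-embed A)))
                        (cong (foldr _xor_ false) (sym (List.map-∘ (Δ.below A))))

    ∑-below-embed : ∀ {j k} (h : Face j → ℕ) (A : Δ.Face k) →
                    ∑ (below (embed A)) h ≡ ∑ (Δ.below A) (h ∘ embed)
    ∑-below-embed h A = trans (∑-↭ h (below-embed A)) (cong sum (sym (List.map-∘ (Δ.below A))))

-- Weights and expansion in terms of integer counts

1/-nonNeg : ∀ p .{{_ : ℚ.NonNegative p}} .{{_ : ℚ.NonZero p}} → ℚ.NonNegative (1/ p)
1/-nonNeg (ℚ.mkℚ ℤ.+[1+ _ ] _ _) = _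

-- Turns an upper bound on a distance into a lower bound on expansion: divide `m ≤ q x` by `m` and
-- multiply by `c`, the reciprocal of `q`.
≤-÷ : ∀ {c q m x} .{{_ : ℚ.NonNegative c}} .{{_ : ℚ.NonNegative m}} .{{_ : ℚ.NonZero m}} →
      c ℚ.* q ≡ 1ℚ → m ≤ q ℚ.* x → c ≤ x ℚ.÷ m
≤-÷ {c} {q} {m} {x} c*q≡1 m≤q*x = begin
  c                            ≡⟨ ℚ.*-identityʳ c ⟨
  c ℚ.* 1ℚ                     ≡⟨ cong (c ℚ.*_) (ℚ.*-inverseʳ m) ⟨
  c ℚ.* (m ℚ.* 1/ m)           ≤⟨ ℚ.*-monoˡ-≤-nonNeg c (ℚ.*-monoʳ-≤-nonNeg (1/ m) {{1/-nonNeg m}} m≤q*x) ⟩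
  c ℚ.* (q ℚ.* x ℚ.* 1/ m)     ≡⟨ cong (c ℚ.*_) (ℚ.*-assoc q x (1/ m)) ⟩
  c ℚ.* (q ℚ.* (x ℚ.* 1/ m))   ≡⟨ ℚ.*-assoc c q (x ℚ.* 1/ m) ⟨
  c ℚ.* q ℚ.* (x ℚ.* 1/ m)     ≡⟨ cong (ℚ._* (x ℚ.* 1/ m)) c*q≡1 ⟩
  1ℚ ℚ.* (x ℚ.* 1/ m)          ≡⟨ ℚ.*-identityˡ _ ⟩
  x ℚ.* 1/ m ∎
  where open ℚ.≤-Reasoning

module Weights (X : SimplicialComplex) (n : ℕ) where
  open SimplicialComplex X
  open Cohomology X n
  open Faces X n

  toℚᵘ-ratio : ∀ a b → ℚ.toℚᵘ (ratio a (suc b)) ℚᵘ.≃ ℚᵘ.mkℚᵘ (ℤ.+ a) b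
  toℚᵘ-ratio a b = ℚ.toℚᵘ-fromℚᵘ (ℚᵘ.mkℚᵘ (ℤ.+ a) b)

  ratio-+ : ∀ a c b → ratio a b ℚ.+ ratio c b ≡ ratio (a + c) b
  ratio-+ a c zero    = refl
  ratio-+ a c (suc b) = ℚ.toℚᵘ-injective (begin-equality
    ℚ.toℚᵘ (ratio a (suc b) ℚ.+ ratio c (suc b))
      ≃⟨ ℚ.toℚᵘ-homo-+ (ratio a (suc b)) (ratio c (suc b)) ⟩
    ℚ.toℚᵘ (ratio a (suc b)) ℚᵘ.+ ℚ.toℚᵘ (ratio c (suc b))
      ≃⟨ ℚᵘ.+-cong (toℚᵘ-ratio a b) (toℚᵘ-ratio c b) ⟩
    ℚᵘ.mkℚᵘ (ℤ.+ a) b ℚᵘ.+ ℚᵘ.mkℚᵘ (ℤ.+ c) b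
      ≃⟨ ℚᵘ.*≡* (trans (cong (ℤ._* ℤ.+ suc b) (sym (ℤ.*-distribʳ-+ (ℤ.+ suc b) (ℤ.+ a) (ℤ.+ c))))
                       (ℤ.*-assoc (ℤ.+ (a + c)) (ℤ.+ suc b) (ℤ.+ suc b))) ⟩
    ℚᵘ.mkℚᵘ (ℤ.+ (a + c)) b
      ≃⟨ toℚᵘ-ratio (a + c) b ⟨
    ℚ.toℚᵘ (ratio (a + c) (suc b)) ∎)
    where open ℚᵘ.≤-Reasoning

  ratio-zero : ∀ b → ratio 0 b ≡ 0ℚ
  ratio-zero zero    = refl
  ratio-zero (suc b) = ℚ.0/n≡0 (suc b)

  ∑-ratio : (b : ℕ) (h : A → ℕ) (xs : List A) → foldr ℚ._+_ 0ℚ (map (λ x → ratio (h x) b) xs) ≡ ratio (∑ xs h) b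
  ∑-ratio b h []       = sym (ratio-zero b)
  ∑-ratio b h (x ∷ xs) = trans (cong (ratio (h x) b ℚ.+_) (∑-ratio b h xs)) (ratio-+ (h x) _ b)

  ratio-nonNeg : ∀ a b → ℚ.NonNegative (ratio a b)
  ratio-nonNeg a zero    = _
  ratio-nonNeg a (suc b) = ℚ.normalize-nonNeg a (suc b)

  ratio-cancel-≤ : ∀ {a c b} → 0 ℕ.< b → ratio a b ≤ ratio c b → a ℕ.≤ c
  ratio-cancel-≤ {a} {c} {suc b} _ le = ℤ.drop‿+≤+ (ℤ.*-cancelʳ-≤-pos (ℤ.+ a) (ℤ.+ c) (ℤ.+ suc b)
    (ℚᵘ.drop-*≤* (ℚᵘ.≤-respˡ-≃ (toℚᵘ-ratio a b) (ℚᵘ.≤-respʳ-≃ (toℚᵘ-ratio c b) (ℚ.toℚᵘ-mono-≤ le)))))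

  ratio-≤ : ∀ {a b c d} k → 0 ℕ.< b → 0 ℕ.< d → a * d ℕ.≤ k * c * b → ratio a b ≤ fromℕ k ℚ.* ratio c d
  ratio-≤ {a} {suc b} {c} {suc d} k _ _ le = ℚ.toℚᵘ-cancel-≤ (begin
    ℚ.toℚᵘ (ratio a (suc b))
      ≃⟨ toℚᵘ-ratio a b ⟩
    ℚᵘ.mkℚᵘ (ℤ.+ a) b
      ≤⟨ ℚᵘ.*≤* (subst₂ ℤ._≤_ lhs rhs (ℤ.+≤+ le)) ⟩
    ℚᵘ.mkℚᵘ (ℤ.+ k) 0 ℚᵘ.* ℚᵘ.mkℚᵘ (ℤ.+ c) d
      ≃⟨ ℚᵘ.*-cong (toℚᵘ-ratio k 0) (toℚᵘ-ratio c d) ⟨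
    ℚ.toℚᵘ (fromℕ k) ℚᵘ.* ℚ.toℚᵘ (ratio c (suc d))
      ≃⟨ ℚ.toℚᵘ-homo-* (fromℕ k) (ratio c (suc d)) ⟨
    ℚ.toℚᵘ (fromℕ k ℚ.* ratio c (suc d)) ∎)
    where
    open ℚᵘ.≤-Reasoning
    lhs : ℤ.+ (a * suc d) ≡ ℤ.+ a ℤ.* ℤ.+ suc (d + 0)
    lhs = trans (ℤ.pos-* a (suc d)) (cong (λ e → ℤ.+ a ℤ.* ℤ.+ suc e) (sym (ℕ.+-identityʳ d)))
    rhs : ℤ.+ (k * c * suc b) ≡ ℤ.+ k ℤ.* ℤ.+ c ℤ.* ℤ.+ suc b
    rhs = trans (ℤ.pos-* (k * c) (suc b)) (cong (ℤ._* ℤ.+ suc b) (ℤ.pos-* k c))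

  chambersAbove : ∀ {j} → Face j → ℕ
  chambersAbove τ = length (filter (λ σ → support τ ⊆? support σ) (faces (suc n)))

  -- The weight of the support of χ, up to the denominator in `weight`.
  mass : ∀ {j} → Cochain j → ℕ
  mass {j} χ = ∑ (faces j) λ τ → ⟦ χ τ ⟧ * chambersAbove τ

  denominator : ℕ → ℕ
  denominator j = (suc n C j) * length (faces (suc n))

  norm≡mass : ∀ {j} (χ : Cochain j) → ∥ χ ∥ ≡ ratio (mass χ) (denominator j)
  norm≡mass {j} χ = trans (∑-ratio (denominator j) chambersAbove (filterᵇ χ (faces j)))
    (cong (λ a → ratio a (denominator j)) (∑-filterᵇ χ (faces j) chambersAbove))

  -- Double counting of pairs: a face in the support of `χ` and a top face above it.
  mass≡∑-below : ∀ {j} (χ : Cochain j) → mass χ ≡ ∑ (faces (suc n)) λ σ → ∑ (below σ) (⟦_⟧ ∘ χ)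
  mass≡∑-below {j} χ = begin
    ∑ (faces j) (λ τ → ⟦ χ τ ⟧ * chambersAbove τ)
      ≡⟨ ∑-cong (faces j) (λ τ → trans (cong (⟦ χ τ ⟧ *_) (length-filter (λ σ → support τ ⊆? support σ) (faces (suc n))))
                                       (sym (∑-* (faces (suc n)) ⟦ χ τ ⟧ _))) ⟩
    ∑ (faces j) (λ τ → ∑ (faces (suc n)) λ σ → ⟦ χ τ ⟧ * ⟦ does (support τ ⊆? support σ) ⟧)
      ≡⟨ ∑-swap (faces j) (faces (suc n)) _ ⟩
    ∑ (faces (suc n)) (λ σ → ∑ (faces j) λ τ → ⟦ χ τ ⟧ * ⟦ does (support τ ⊆? support σ) ⟧)
      ≡⟨ ∑-cong (faces (suc n)) (λ σ → ∑-cong (faces j) λ τ → ℕ.*-comm ⟦ χ τ ⟧ _) ⟩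
    ∑ (faces (suc n)) (λ σ → ∑ (faces j) λ τ → ⟦ does (support τ ⊆? support σ) ⟧ * ⟦ χ τ ⟧)
      ≡⟨ ∑-cong (faces (suc n)) (λ σ → ∑-filter (λ τ → support τ ⊆? support σ) (faces j) (⟦_⟧ ∘ χ)) ⟨
    ∑ (faces (suc n)) (λ σ → ∑ (below σ) (⟦_⟧ ∘ χ)) ∎
    where open ≡-Reasoning

  expansion-≥ : ∀ {j c} k .{{_ : ℚ.NonNegative c}} → c ℚ.* fromℕ k ≡ 1ℚ →
    (∀ (φ : Cochain (suc j)) {m} → IsDistanceToB φ m → m ≤ fromℕ k ℚ.* ∥ d φ ∥) →
    ∀ e → IsExp j e → c ≤ e
  expansion-≥ {j} k {{c≥0}} c*k≡1 bound e ((φ , _ , m , distance@((ψ , _ , m≡) , _) , m≢0 , refl) , _) =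
    -- Division by `m` is legitimate: `IsExp` supplies that it is nonzero, and it is nonnegative as
    -- the norm of `φ +ᶜ ψ`.
    ≤-÷ {{c≥0}} {{subst ℚ.NonNegative (sym (trans m≡ (norm≡mass (φ +ᶜ ψ))))
                        (ratio-nonNeg (mass (φ +ᶜ ψ)) (denominator (suc j)))}}
      {{m≢0}} c*k≡1 (bound φ distance)

-- Sums over a finite group and its orbits

lookup-injective : {xs : List A} → Unique xs → ∀ {i j} → List.lookup xs i ≡ List.lookup xs j → i ≡ j
lookup-injective (x∉xs ∷ xs!) {zero}  {zero}  eq = refl
lookup-injective (x∉xs ∷ xs!) {zero}  {suc j} eq = contradiction eq (All.lookup x∉xs (∈-lookup j))
lookup-injective (x∉xs ∷ xs!) {suc i} {zero}  eq = contradiction (sym eq) (All.lookup x∉xs (∈-lookup i))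
lookup-injective (x∉xs ∷ xs!) {suc i} {suc j} eq = cong suc (lookup-injective xs! eq)

does≡true⇒ : {P : Set} (P? : Dec P) → does P? ≡ true → P
does≡true⇒ (yes p) _ = p

∑-map : (f : A → B) (xs : List A) (h : B → ℕ) → ∑ (map f xs) h ≡ ∑ xs (h ∘ f)
∑-map f xs h = cong sum (sym (List.map-∘ xs))

module GroupSums (G : FiniteGroup) where
  open FiniteGroup G

  group : Group 0ℓ 0ℓ
  group = record { isGroup = isGroup }
  open Group group public using (assoc; identityˡ; identityʳ; inverseˡ; inverseʳ)
  open Algebra.Properties.Group group public
    using (⁻¹-anti-homo-∙; ⁻¹-involutive; ∙-cancelˡ; ∙-cancelʳ; ε⁻¹≈ε)

  x∙[x⁻¹∙y]≡y : ∀ x y → x ∙ (x ⁻¹ ∙ y) ≡ y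
  x∙[x⁻¹∙y]≡y x y = trans (sym (assoc x (x ⁻¹) y)) (trans (cong (_∙ y) (inverseʳ x)) (identityˡ y))

  x⁻¹∙[x∙y]≡y : ∀ x y → x ⁻¹ ∙ (x ∙ y) ≡ y
  x⁻¹∙[x∙y]≡y x y = trans (sym (assoc (x ⁻¹) x y)) (trans (cong (_∙ y) (inverseˡ x)) (identityˡ y))

  [y∙x⁻¹]∙x≡y : ∀ x y → y ∙ x ⁻¹ ∙ x ≡ y
  [y∙x⁻¹]∙x≡y x y = trans (assoc y (x ⁻¹) x) (trans (cong (y ∙_) (inverseˡ x)) (identityʳ y))

  index : Carrier → Fin order
  index = Inverse.from enumeration

  element-index : ∀ g → element (index g) ≡ g
  element-index = Inverse.strictlyInverseˡ enumeration

  element-injective : ∀ {i j} → element i ≡ element j → i ≡ j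
  element-injective {i} {j} eq = trans (sym (Inverse.strictlyInverseʳ enumeration i))
    (trans (cong index eq) (Inverse.strictlyInverseʳ enumeration j))

  infix 4 _≟ᴳ_
  _≟ᴳ_ : (g h : Carrier) → Dec (g ≡ h)
  g ≟ᴳ h with index g Fin.≟ index h
  ... | yes eq = yes (trans (sym (element-index g)) (trans (cong element eq) (element-index h)))
  ... | no neq = no (neq ∘ cong index)

  elements : List Carrier
  elements = map element (allFin order)

  elements-unique : Unique elements
  elements-unique = Unique.map⁺ element-injective (Unique.allFin⁺ order)

  elements-complete : ∀ g → g ∈ elements
  elements-complete g = subst (_∈ elements) (element-index g) (∈-map⁺ element (∈-allFin (index g)))

  ∑-bijection : (f f⁻¹ : Carrier → Carrier) → (∀ {x y} → f x ≡ f y → x ≡ y) → (∀ x → f (f⁻¹ x) ≡ x) →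
                (h : Carrier → ℕ) → ∑ elements (h ∘ f) ≡ ∑ elements h
  ∑-bijection f f⁻¹ f-inj f-f⁻¹ h = trans (sym (∑-map f elements h)) (∑-↭ h
    (unique∧set⇒↭ (Unique.map⁺ f-inj elements-unique) elements-unique
      (λ _ → elements-complete _)
      (λ {x} _ → subst (_∈ map f elements) (f-f⁻¹ x) (∈-map⁺ f (elements-complete _)))))

  ∑-translateˡ : ∀ x (h : Carrier → ℕ) → ∑ elements (λ g → h (x ∙ g)) ≡ ∑ elements h
  ∑-translateˡ x = ∑-bijection (x ∙_) (x ⁻¹ ∙_) (∙-cancelˡ x _ _) (x∙[x⁻¹∙y]≡y x)

  ∑-translateʳ : ∀ x (h : Carrier → ℕ) → ∑ elements (λ g → h (g ∙ x)) ≡ ∑ elements h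
  ∑-translateʳ x = ∑-bijection (_∙ x) (_∙ x ⁻¹) (∙-cancelʳ x _ _) ([y∙x⁻¹]∙x≡y x)

  -- The fibres of g ↦ g . s over an orbit are translates of one another, hence equinumerous.
  module Orbit {S : Set} (_≟_ : (s t : S) → Dec (s ≡ t)) (f : Carrier → S)
               (f-translate : ∀ x {g h} → f g ≡ f h → f (x ∙ g) ≡ f (x ∙ h)) where

    stabiliserOrder : ℕ
    stabiliserOrder = ∑ elements λ g → ⟦ does (f ε ≟ f g) ⟧

    stabiliserOrder>0 : 0 ℕ.< stabiliserOrder
    stabiliserOrder>0 = subst (ℕ._≤ stabiliserOrder) (⟦does⟧-yes (f ε ≟ f ε) refl)
      (∈⇒≤∑ (λ g → ⟦ does (f ε ≟ f g) ⟧) (elements-complete ε))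

    fibre-size : ∀ x → ∑ elements (λ g → ⟦ does (f x ≟ f g) ⟧) ≡ stabiliserOrder
    fibre-size x = trans (sym (∑-translateˡ x _)) (∑-cong elements λ g →
      cong ⟦_⟧ (does-⇔ (mk⇔ (from g) (to g)) (f x ≟ f (x ∙ g)) (f ε ≟ f g)))
      where
      to : ∀ g → f ε ≡ f g → f x ≡ f (x ∙ g)
      to g eq = trans (cong f (sym (identityʳ x))) (f-translate x eq)
      from : ∀ g → f x ≡ f (x ∙ g) → f ε ≡ f g
      from g eq = trans (cong f (sym (inverseˡ x)))
                        (trans (f-translate (x ⁻¹) eq) (cong f (x⁻¹∙[x∙y]≡y x g)))

    ∑-orbit : {ss : List S} → Unique ss → (∀ g → f g ∈ ss) → (∀ {s} → s ∈ ss → ∃ λ g → f g ≡ s) →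
              (h : S → ℕ) → ∑ elements (h ∘ f) ≡ stabiliserOrder * ∑ ss h
    ∑-orbit {ss} ss! f∈ss onto h = begin
      ∑ elements (h ∘ f)
        ≡⟨ ∑-cong elements (λ g → ∑-indicator (_≟ f g) h ss! (f∈ss g) refl id) ⟨
      ∑ elements (λ g → ∑ ss (λ s → ⟦ does (s ≟ f g) ⟧ * h s))
        ≡⟨ ∑-swap elements ss _ ⟩
      ∑ ss (λ s → ∑ elements (λ g → ⟦ does (s ≟ f g) ⟧ * h s))
        ≡⟨ ∑-cong∈ ss fibre ⟩
      ∑ ss (λ s → stabiliserOrder * h s)
        ≡⟨ ∑-* ss stabiliserOrder h ⟩
      stabiliserOrder * ∑ ss h ∎
      where
      open ≡-Reasoning
      fibre : ∀ {s} → s ∈ ss → ∑ elements (λ g → ⟦ does (s ≟ f g) ⟧ * h s) ≡ stabiliserOrder * h s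
      fibre s∈ss with onto s∈ss
      ... | x , refl = begin
        ∑ elements (λ g → ⟦ does (f x ≟ f g) ⟧ * h (f x))
          ≡⟨ ∑-cong elements (λ g → ℕ.*-comm _ (h (f x))) ⟩
        ∑ elements (λ g → h (f x) * ⟦ does (f x ≟ f g) ⟧)
          ≡⟨ ∑-* elements (h (f x)) _ ⟩
        h (f x) * ∑ elements (λ g → ⟦ does (f x ≟ f g) ⟧)
          ≡⟨ cong (h (f x) *_) (fibre-size x) ⟩
        h (f x) * stabiliserOrder
          ≡⟨ ℕ.*-comm (h (f x)) _ ⟩
        stabiliserOrder * h (f x) ∎

-- Faces of the coset complex as translates of faces of a base chamber

module Complex (G : FiniteGroup) (n : ℕ) (K : Fin (suc n) → Subgroup G) where
  open FiniteGroup G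
  open GroupSums G
  open Subgroup
  open CosetComplex G K
  open Cohomology complex n
  open Faces complex n
  open Embedding complex n (suc n)

  infix 4 _≈[_]_
  -- Equality of the cosets `xKᵢ` and `yKᵢ`.
  _≈[_]_ : Carrier → Fin (suc n) → Carrier → Set
  x ≈[ i ] y = Member (K i) (x ⁻¹ ∙ y)

  ≈-refl : ∀ i {x} → x ≈[ i ] x
  ≈-refl i {x} = subst (Member (K i)) (sym (inverseˡ x)) (ε-closed (K i))

  ≈-sym : ∀ i {x y} → x ≈[ i ] y → y ≈[ i ] x
  ≈-sym i {x} {y} p = subst (Member (K i))
    (trans (⁻¹-anti-homo-∙ (x ⁻¹) y) (cong (y ⁻¹ ∙_) (⁻¹-involutive x))) (⁻¹-closed (K i) p)

  ≈-trans : ∀ i {x y z} → x ≈[ i ] y → y ≈[ i ] z → x ≈[ i ] z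
  ≈-trans i {x} {y} {z} p q = subst (Member (K i))
    (trans (assoc (x ⁻¹) y (y ⁻¹ ∙ z)) (cong (x ⁻¹ ∙_) (x∙[x⁻¹∙y]≡y y z))) (∙-closed (K i) p q)

  translate-⁻¹ : ∀ g x y → (g ∙ x) ⁻¹ ∙ (g ∙ y) ≡ x ⁻¹ ∙ y
  translate-⁻¹ g x y = trans (cong (_∙ (g ∙ y)) (⁻¹-anti-homo-∙ g x))
    (trans (assoc (x ⁻¹) (g ⁻¹) (g ∙ y)) (cong (x ⁻¹ ∙_) (x⁻¹∙[x∙y]≡y g y)))

  ≈-translate : ∀ i g {x y} → x ≈[ i ] y → g ∙ x ≈[ i ] g ∙ y
  ≈-translate i g {x} {y} = subst (Member (K i)) (sym (translate-⁻¹ g x y))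

  ≈-∙ : ∀ i x {k} → Member (K i) k → x ≈[ i ] x ∙ k
  ≈-∙ i x {k} = subst (Member (K i)) (sym (x⁻¹∙[x∙y]≡y x k))

  ∈-coset⁺ : ∀ i g {x} → g ≈[ i ] element x → x ∈ˢ coset i g
  ∈-coset⁺ i g {x} p = Vec.lookup⇒[]= x (coset i g)
    (trans (Vec.lookup∘tabulate _ x) (dec-true (member? (K i) (g ⁻¹ ∙ element x)) p))

  ∈-coset⁻ : ∀ i g {x} → x ∈ˢ coset i g → g ≈[ i ] element x
  ∈-coset⁻ i g {x} p = does≡true⇒ (member? (K i) (g ⁻¹ ∙ element x))
    (trans (sym (Vec.lookup∘tabulate _ x)) (Vec.[]=⇒lookup p))

  index∈coset : ∀ i g → index g ∈ˢ coset i g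
  index∈coset i g = ∈-coset⁺ i g (subst (g ≈[ i ]_) (sym (element-index g)) (≈-refl i))

  coset-cong : ∀ i {g h} → g ≈[ i ] h → coset i g ≡ coset i h
  coset-cong i {g} {h} p = Vec.tabulate-cong λ x →
    does-⇔ (mk⇔ (≈-trans i (≈-sym i p)) (≈-trans i p)) (member? (K i) _) (member? (K i) _)

  coset-injective : ∀ i {g h} → coset i g ≡ coset i h → g ≈[ i ] h
  coset-injective i {g} {h} eq = subst (g ≈[ i ]_) (element-index h)
    (∈-coset⁻ i g (subst (index h ∈ˢ_) (sym eq) (index∈coset i h)))

  vertexList-unique : Unique vertexList
  vertexList-unique = Unique.concat⁺
    (All.map⁺ (All.tabulate λ {i} _ → Unique.map⁺ (λ { refl → refl }) (Dedup.deduplicate-! (Vec.≡-dec Bool._≟_) _)))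
    (AllPairs.map⁺ (AllPairs.map disjoint (Unique.allFin⁺ (suc n))))
    where
    disjoint : ∀ {i j} → i ≢ j → ∀ {v} → ¬ (v ∈ map (i ,_) (cosets i) × v ∈ map (j ,_) (cosets j))
    disjoint i≢j (p , q) with ∈-map⁻ _ p | ∈-map⁻ _ q
    ... | _ , _ , refl | _ , _ , refl = i≢j refl

  ∈-vertexList : ∀ i g → (i , coset i g) ∈ vertexList
  ∈-vertexList i g = ∈-concatMap⁺ (λ i → map (i ,_) (cosets i))
    (Any.map (λ { refl → ∈-map⁺ (i ,_) coset∈ }) (∈-allFin i))
    where
    coset∈ : coset i g ∈ cosets i
    coset∈ = ∈-deduplicate⁺ (Vec.≡-dec Bool._≟_)
      (subst (λ h → coset i h ∈ map (coset i ∘ element) (allFin order)) (element-index g)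
        (∈-map⁺ (coset i ∘ element) (∈-allFin (index g))))

  vertex-injective : ∀ {u v} → vertex u ≡ vertex v → u ≡ v
  vertex-injective = lookup-injective vertexList-unique

  abstract
    -- The vertex `gKᵢ`. It is opaque because its position in the list is immaterial; `vertex-pt` is
    -- all that is used later.
    pt : Carrier → Fin (suc n) → Fin V
    pt g i = Any.index (∈-vertexList i g)

    vertex-pt : ∀ g i → vertex (pt g i) ≡ (i , coset i g)
    vertex-pt g i = sym (Any.lookup-index (∈-vertexList i g))

  pt-cong : ∀ i {g h} → g ≈[ i ] h → pt g i ≡ pt h i
  pt-cong i {g} {h} p = vertex-injective
    (trans (vertex-pt g i) (trans (cong (i ,_) (coset-cong i p)) (sym (vertex-pt h i))))

  pt-injective : ∀ {g h i j} → pt g i ≡ pt h j → i ≡ j × g ≈[ i ] h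
  pt-injective {g} {h} {i} {j} eq
    with refl ← cong proj₁ (trans (sym (vertex-pt g i)) (trans (cong vertex eq) (vertex-pt h j)))
    = refl , coset-injective i (cong proj₂ (trans (sym (vertex-pt g i)) (trans (cong vertex eq) (vertex-pt h i))))

  pt-distinct : ∀ g {i j} → pt g i ≡ pt g j → i ≡ j
  pt-distinct g eq = proj₁ (pt-injective {g} {g} eq)

  pt-simplex : ∀ g → Clique (image (pt g) ⊤)
  pt-simplex g u v u∈ v∈ u≢v with ∈-image⁻ (pt g) ⊤ u∈ | ∈-image⁻ (pt g) ⊤ v∈
  ... | i , _ , refl | j , _ , refl rewrite vertex-pt g i | vertex-pt g j =
    (λ { refl → u≢v refl }) , index g , x∈p∩q⁺ (index∈coset i g , index∈coset j g)

  abstract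
    -- The face with vertices `gKᵢ` for the types `i` in `B`; these cosets all contain `g`.
    F : ∀ {j} → Carrier → Δ.Face j → Face j
    F g = embed (pt g) (pt-distinct g) (pt-simplex g)

    ∈-F⁺ : ∀ {j} g (B : Δ.Face j) {i} → i ∈ˢ Δ.support B → pt g i ∈ˢ support (F g B)
    ∈-F⁺ g B = ∈-image⁺ (pt g)

    ∈-F⁻ : ∀ {j} g (B : Δ.Face j) {v} → v ∈ˢ support (F g B) → ∃ λ i → i ∈ˢ Δ.support B × pt g i ≡ v
    ∈-F⁻ g B = ∈-image⁻ (pt g) (Δ.support B)

    F-cong : ∀ {j x y} (B : Δ.Face j) → (∀ {i} → i ∈ˢ Δ.support B → x ≈[ i ] y) → F x B ≡ F y B
    F-cong B x≈y = support-injective (image-cong (λ {i} i∈B → pt-cong i (x≈y i∈B)))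

    d-F : ∀ {j} (φ : Cochain j) g (B : Δ.Face (suc j)) → d φ (F g B) ≡ Δ.d (φ ∘ F g) B
    d-F φ g = d-embed (pt g) (pt-distinct g) (pt-simplex g) φ

    ∑-below-F : ∀ {j k} g (h : Face j → ℕ) (B : Δ.Face k) → ∑ (below (F g B)) h ≡ ∑ (Δ.below B) (h ∘ F g)
    ∑-below-F g = ∑-below-embed (pt g) (pt-distinct g) (pt-simplex g)

  F-cong⁻ : ∀ {j x y} (B : Δ.Face j) → F x B ≡ F y B → ∀ {i} → i ∈ˢ Δ.support B → x ≈[ i ] y
  F-cong⁻ {x = x} {y} B eq {i} i∈B
    with ∈-F⁻ y B (subst (pt x i ∈ˢ_) (cong support eq) (∈-F⁺ x B i∈B))
  ... | i′ , _ , eq′ with refl , y≈x ← pt-injective {y} {x} {i′} {i} eq′ = ≈-sym i y≈x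

  F-translate : ∀ {j} (B : Δ.Face j) x {g h} → F g B ≡ F h B → F (x ∙ g) B ≡ F (x ∙ h) B
  F-translate B x eq = F-cong B λ {i} i∈B → ≈-translate i x (F-cong⁻ B eq i∈B)

  chamber : Δ.Face (suc n)
  chamber = Δ.face ⊤ (tt , ∣⊤∣≡n (suc n))

  infix 4 _≟ᶠ_
  _≟ᶠ_ : ∀ {j} (σ τ : Face j) → Dec (σ ≡ τ)
  σ ≟ᶠ τ with Vec.≡-dec Bool._≟_ (support σ) (support τ)
  ... | yes eq = yes (support-injective eq)
  ... | no neq = no (neq ∘ cong support)

  module Transitive (transitive : TransitiveOn n) where

    -- Cosets that meet pairwise need not have a common element, so a clique with one vertex of each
    -- type need not be a translate of the base chamber. Transitivity supplies this: any top face is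
    -- the translate of `F ε chamber` by some `h`.
    F-onto : (σ : Face (suc n)) → ∃ λ h → F h chamber ≡ σ
    F-onto σ with transitive (F ε chamber) σ
    ... | h , ε↦σ = h , support-injective (⊆-antisym to from)
      where
      -- The relation `h · u ↦ v` admits any representative of the coset at `u`; the coset of the
      -- translate does not depend on it, which pins `v` down.
      translate-pt : ∀ i {v} → h · pt ε i ↦ v → pt h i ≡ v
      translate-pt i {v} (i′ , g , u≡ , v≡)
        with refl ← cong proj₁ (trans (sym (vertex-pt ε i)) u≡)
        = vertex-injective (trans (vertex-pt h i) (trans (cong (i ,_) (coset-cong i h≈hg)) (sym v≡)))
        where
        ε≈g : ε ≈[ i ] g
        ε≈g = coset-injective i (cong proj₂ (trans (sym (vertex-pt ε i)) u≡))
        h≈hg : h ≈[ i ] h ∙ g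
        h≈hg = subst (_≈[ i ] h ∙ g) (identityʳ h) (≈-translate i h ε≈g)
      ptε↦pth : ∀ i → h · pt ε i ↦ pt h i
      ptε↦pth i = i , ε , vertex-pt ε i , trans (vertex-pt h i) (cong (λ g → i , coset i g) (sym (identityʳ h)))
      to : support (F h chamber) ⊆ support σ
      to v∈ with ∈-F⁻ h chamber v∈
      ... | i , i∈ , refl = Equivalence.from (ε↦σ (pt h i)) (pt ε i , ∈-F⁺ ε chamber i∈ , ptε↦pth i)
      from : support σ ⊆ support (F h chamber)
      from {v} v∈ with Equivalence.to (ε↦σ v) v∈
      ... | u , u∈ , u↦v with ∈-F⁻ ε chamber u∈
      ... | i , i∈ , refl = subst (_∈ˢ support (F h chamber)) (translate-pt i u↦v) (∈-F⁺ h chamber i∈)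

-- Averaging over translates

module Averaging (G : FiniteGroup) (n : ℕ) (K : Fin (suc n) → Subgroup G)
                 (transitive : CosetComplex.TransitiveOn G K n) where
  open FiniteGroup G
  open GroupSums G
  open CosetComplex G K
  open Cohomology complex n
  open Faces complex n
  open Weights complex n
  open Complex G n K
  open Embedding complex n (suc n)
  open Transitive transitive
  open Orbit _≟ᶠ_ (λ g → F g chamber) (F-translate chamber) public

  -- As `g` runs over the group, `F g chamber` hits each top face exactly `stabiliserOrder` times.
  mass-orbit : ∀ {j} (χ : Cochain j) →
    stabiliserOrder * mass χ ≡ ∑ elements λ g → ∑ (Δ.below chamber) λ B → ⟦ χ (F g B) ⟧
  mass-orbit {j} χ = begin
    stabiliserOrder * mass χ
      ≡⟨ cong (stabiliserOrder *_) (mass≡∑-below χ) ⟩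
    stabiliserOrder * ∑ (faces (suc n)) (λ σ → ∑ (below σ) (⟦_⟧ ∘ χ))
      ≡⟨ ∑-orbit (faces-unique (suc n)) (λ g → faces-complete (F g chamber)) (λ {σ} _ → F-onto σ) _ ⟨
    ∑ elements (λ g → ∑ (below (F g chamber)) (⟦_⟧ ∘ χ))
      ≡⟨ ∑-cong elements (λ g → ∑-below-F g (⟦_⟧ ∘ χ) chamber) ⟩
    ∑ elements (λ g → ∑ (Δ.below chamber) λ B → ⟦ χ (F g B) ⟧) ∎
    where open ≡-Reasoning

  faces>0 : 0 ℕ.< length (faces (suc n))
  faces>0 = ∈-length (faces-complete (F ε chamber))

  -- A minimum is at most an average: sum the bound by `a` over all `g`, exchange the sums, and
  -- estimate them for one relative position and one face at a time.
  average : ∀ {j a b} (χ : Carrier → Cochain j) → (∀ g → a ℕ.≤ mass (χ g)) →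
    All (λ B → ∀ x → ∑ elements (λ g → ⟦ χ g (F (g ∙ x) B) ⟧) ℕ.≤ b) (Δ.below chamber) →
    stabiliserOrder * a ℕ.≤ length (Δ.below {j} chamber) * b
  average {j} {a} {b} χ a≤mass bounds = ℕ.*-cancelˡ-≤ (length elements)
    {{ℕ.>-nonZero (∈-length (elements-complete ε))}} (begin
    length elements * (stabiliserOrder * a)
      ≡⟨ ∑-const elements _ ⟨
    ∑ elements (λ _ → stabiliserOrder * a)
      ≤⟨ ∑-mono elements (λ g → ℕ.*-monoʳ-≤ stabiliserOrder (a≤mass g)) ⟩
    ∑ elements (λ g → stabiliserOrder * mass (χ g))
      -- Running over `g ∙ x` instead of `x` makes `x` the position relative to the cone at `g`, so
      -- that for a fixed `x` only the sum over `g` is left to bound.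
      ≡⟨ ∑-cong elements (λ g → trans (mass-orbit (χ g)) (sym (∑-translateˡ g _))) ⟩
    ∑ elements (λ g → ∑ elements λ x → ∑ (Δ.below chamber) λ B → ⟦ χ g (F (g ∙ x) B) ⟧)
      ≡⟨ ∑-swap elements elements _ ⟩
    ∑ elements (λ x → ∑ elements λ g → ∑ (Δ.below chamber) λ B → ⟦ χ g (F (g ∙ x) B) ⟧)
      ≡⟨ ∑-cong elements (λ x → ∑-swap elements (Δ.below chamber) _) ⟩
    ∑ elements (λ x → ∑ (Δ.below chamber) λ B → ∑ elements λ g → ⟦ χ g (F (g ∙ x) B) ⟧)
      ≤⟨ ∑-mono elements (λ x → ∑-mono-All (All.map (λ bound → bound x) bounds)) ⟩
    ∑ elements (λ _ → ∑ (Δ.below {j} chamber) λ _ → b)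
      ≡⟨ ∑-cong elements (λ _ → ∑-const (Δ.below {j} chamber) b) ⟩
    ∑ elements (λ _ → length (Δ.below {j} chamber) * b)
      ≡⟨ ∑-const elements _ ⟩
    length elements * (length (Δ.below {j} chamber) * b) ∎)
    where open ℕ.≤-Reasoning

  -- `c` is the cost of one face of a chamber; `k` has to absorb the number of these faces and the
  -- ratio of the two denominators in the weights.
  distance-≤ : ∀ {j} (φ : Cochain (suc j)) (c k : ℕ) (ψ : Carrier → Cochain (suc j)) →
    (∀ g → IsCoboundary (ψ g)) →
    All (λ B → ∀ x → ∑ elements (λ g → ⟦ (φ +ᶜ ψ g) (F (g ∙ x) B) ⟧) ℕ.≤ c * (stabiliserOrder * mass (d φ)))
      (Δ.below chamber) →
    0 ℕ.< denominator (suc j) → 0 ℕ.< denominator (suc (suc j)) →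
    length (Δ.below {suc j} chamber) * c * denominator (suc (suc j)) ℕ.≤ k * denominator (suc j) →
    ∀ {m} → IsDistanceToB φ m → m ≤ fromℕ k ℚ.* ∥ d φ ∥
  distance-≤ {j} φ c k ψ coboundary bounds D>0 D′>0 le {m} ((ψ₀ , _ , m≡) , least) =
    subst₂ (λ p q → p ≤ fromℕ k ℚ.* q) (sym m≡ratio) (sym (norm≡mass (d φ))) (ratio-≤ k D>0 D′>0 cross)
    where
    open ℕ.≤-Reasoning
    a ℓ Dⱼ D′ H : ℕ
    a = mass (φ +ᶜ ψ₀)
    ℓ = length (Δ.below {suc j} chamber)
    Dⱼ = denominator (suc j)
    D′ = denominator (suc (suc j))
    H = stabiliserOrder
    m≡ratio : m ≡ ratio a Dⱼ
    m≡ratio = trans m≡ (norm≡mass (φ +ᶜ ψ₀))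
    a≤mass : ∀ g → a ℕ.≤ mass (φ +ᶜ ψ g)
    a≤mass g = ratio-cancel-≤ D>0 (subst₂ _≤_ m≡ratio (norm≡mass (φ +ᶜ ψ g)) (least _ (ψ g , coboundary g , refl)))
    a≤ : a ℕ.≤ ℓ * c * mass (d φ)
    a≤ = ℕ.*-cancelˡ-≤ H {{ℕ.>-nonZero stabiliserOrder>0}} (begin
      H * a                     ≤⟨ average (λ g → φ +ᶜ ψ g) a≤mass bounds ⟩
      ℓ * (c * (H * mass (d φ)))
        ≡⟨ solve 4 (λ ℓ c H M → ℓ :* (c :* (H :* M)) := H :* (ℓ :* c :* M)) refl ℓ c H (mass (d φ)) ⟩
      H * (ℓ * c * mass (d φ))  ∎)
      where open +-*-Solver
    cross : a * D′ ℕ.≤ k * mass (d φ) * Dⱼ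
    cross = begin
      a * D′                   ≤⟨ ℕ.*-monoˡ-≤ D′ a≤ ⟩
      ℓ * c * mass (d φ) * D′  ≡⟨ solve 3 (λ x M y → x :* M :* y := x :* y :* M) refl (ℓ * c) (mass (d φ)) D′ ⟩
      ℓ * c * D′ * mass (d φ)  ≤⟨ ℕ.*-monoˡ-≤ (mass (d φ)) le ⟩
      k * Dⱼ * mass (d φ)      ≡⟨ solve 3 (λ x M y → x :* y :* M := x :* M :* y) refl k (mass (d φ)) Dⱼ ⟩
      k * mass (d φ) * Dⱼ      ∎
      where open +-*-Solver

-- `P` is not assumed decidable, hence the double negation. If there were no least element,
-- induction would exclude all witnesses below `n`, and `n` itself would be least.
least-exists : (P : ℕ → Set) → ∀ n → P n → ¬ ¬ ∃ (IsLeast ℕ._≤_ P)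
least-exists P = <-rec _ λ n rec Pn → λ no-least → no-least (n , Pn , λ m Pm →
  ℕ.≮⇒≥ λ m<n → rec m<n Pm no-least)

-- Translation-invariant counting on the group

module Measure (G : FiniteGroup) where
  open FiniteGroup G
  open GroupSums G

  μ : (Carrier → Bool) → ℕ
  μ h = ∑ elements (⟦_⟧ ∘ h)

  μ-cong : ∀ {h k} → (∀ g → h g ≡ k g) → μ h ≡ μ k
  μ-cong h≡k = ∑-cong elements (cong ⟦_⟧ ∘ h≡k)

  μ-mono : ∀ {h k} → (∀ g → ⟦ h g ⟧ ℕ.≤ ⟦ k g ⟧) → μ h ℕ.≤ μ k
  μ-mono = ∑-mono elements

  μ-translate : ∀ x h → μ (λ g → h (g ∙ x)) ≡ μ h
  μ-translate x h = ∑-translateʳ x (⟦_⟧ ∘ h)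

  μ-false : μ (λ _ → false) ≡ 0
  μ-false = ∑-zero elements

  μ-xor : ∀ h k → μ (λ g → h g xor k g) ℕ.≤ μ h + μ k
  μ-xor h k = ℕ.≤-trans (∑-mono elements (λ g → ⟦xor⟧≤ (h g) (k g)))
                        (ℕ.≤-reflexive (∑-+ elements (⟦_⟧ ∘ h) (⟦_⟧ ∘ k)))

  μ-xor-≤ : ∀ h k {a b} → μ h ℕ.≤ a → μ k ℕ.≤ b → μ (λ g → h g xor k g) ℕ.≤ a + b
  μ-xor-≤ h k p q = ℕ.≤-trans (μ-xor h k) (ℕ.+-mono-≤ p q)

-- Vertex functions along a word

module Paths (G : FiniteGroup) {r : ℕ} (K : Fin r → Subgroup G) where
  open FiniteGroup G
  open GroupSums G
  open Measure G
  open Subgroup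
  open SubgroupPresentation G K

  module Variation (f : Fin r → Carrier → Bool) (f-invariant : ∀ i g {k} → Member (K i) k → f i (g ∙ k) ≡ f i g)
                   (ν : ℕ) (ν-bound : ∀ i j → μ (λ g → f i g xor f j g) ℕ.≤ ν) where

    -- For a letter `s` in `Kₖ` the vertices `gKₖ` and `gsKₖ` coincide, so a letter costs just one
    -- edge, from the current type to type `k`. The last edge, to type `j`, accounts for the
    -- successor.
    variation : ∀ {w} → All ⋃K w → ∀ i j → μ (λ g → f i g xor f j (g ∙ value w)) ℕ.≤ suc (length w) * ν
    variation [] i j = begin
      μ (λ g → f i g xor f j (g ∙ ε))  ≡⟨ μ-cong (λ g → cong (λ h → f i g xor f j h) (identityʳ g)) ⟩
      μ (λ g → f i g xor f j g)        ≤⟨ ν-bound i j ⟩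
      ν                                ≡⟨ ℕ.+-identityʳ ν ⟨
      ν + 0                            ∎
      where open ℕ.≤-Reasoning
    variation {s ∷ w} ((k , s∈K) ∷ w⊆K) i j = begin
      μ (λ g → f i g xor f j (g ∙ (s ∙ value w)))
        ≡⟨ μ-cong (λ g → trans (cong₂ _xor_ (refl {x = f i g}) (cong (f j) (sym (assoc g s (value w)))))
                               (trans (insert (f i g) (f k g) _)
                               (cong (λ b → (f i g xor f k g) xor (b xor f j (g ∙ s ∙ value w))) (sym (f-invariant k g s∈K))))) ⟩
      μ (λ g → (f i g xor f k g) xor (f k (g ∙ s) xor f j (g ∙ s ∙ value w)))
        ≤⟨ μ-xor-≤ (λ g → f i g xor f k g) (λ g → f k (g ∙ s) xor f j (g ∙ s ∙ value w)) (ν-bound i k)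
             (ℕ.≤-trans (ℕ.≤-reflexive (μ-translate s (λ g → f k g xor f j (g ∙ value w)))) (variation w⊆K k j)) ⟩
      ν + suc (length w) * ν ∎
      where
      open ℕ.≤-Reasoning
      insert : ∀ a b c → a xor c ≡ (a xor b) xor (b xor c)
      insert = solve 3 (λ a b c → a :+ c := (a :+ b) :+ (b :+ c)) refl
        where open xor-∧-Solver

-- Words, free reduction and short spellings

module Words (G : FiniteGroup) {r : ℕ} (K : Fin r → Subgroup G) where
  open FiniteGroup G
  open GroupSums G
  open Subgroup
  open SubgroupPresentation G K

  value-++ : ∀ u v → value (u ++ v) ≡ value u ∙ value v
  value-++ []      v = sym (identityˡ _)
  value-++ (s ∷ u) v = trans (cong (s ∙_) (value-++ u v)) (sym (assoc s _ _))

  inverse-∷ : ∀ s w → inverse (s ∷ w) ≡ inverse w ++ [ s ⁻¹ ]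
  inverse-∷ s w = List.unfold-reverse (s ⁻¹) (map _⁻¹ w)

  value-inverse : ∀ w → value (inverse w) ≡ value w ⁻¹
  value-inverse []      = sym ε⁻¹≈ε
  value-inverse (s ∷ w) = begin
    value (inverse (s ∷ w))          ≡⟨ cong value (inverse-∷ s w) ⟩
    value (inverse w ++ [ s ⁻¹ ])    ≡⟨ value-++ (inverse w) [ s ⁻¹ ] ⟩
    value (inverse w) ∙ (s ⁻¹ ∙ ε)   ≡⟨ cong₂ _∙_ (value-inverse w) (identityʳ _) ⟩
    value w ⁻¹ ∙ s ⁻¹                ≡⟨ ⁻¹-anti-homo-∙ s (value w) ⟨
    (s ∙ value w) ⁻¹                 ∎
    where open ≡-Reasoning

  inverse⊆⋃K : ∀ {w} → All ⋃K w → All ⋃K (inverse w)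
  inverse⊆⋃K []                    = []
  inverse⊆⋃K {s ∷ w} ((i , p) ∷ w⊆) = subst (All ⋃K) (sym (inverse-∷ s w))
    (All.++⁺ (inverse⊆⋃K w⊆) ((i , ⁻¹-closed (K i) p) ∷ []))

  length-inverse : ∀ w → length (inverse w) ≡ length w
  length-inverse w = trans (List.length-reverse (map _⁻¹ w)) (List.length-map _⁻¹ w)

  value-⟶ : ∀ {w w′} → w ⟶ w′ → value w ≡ value w′
  value-⟶ (cancel u {s} v _) = begin
    value (u ++ s ∷ s ⁻¹ ∷ v)              ≡⟨ value-++ u _ ⟩
    value u ∙ (s ∙ (s ⁻¹ ∙ value v))       ≡⟨ cong (value u ∙_) (x∙[x⁻¹∙y]≡y s (value v)) ⟩
    value u ∙ value v                      ≡⟨ value-++ u v ⟨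
    value (u ++ v)                         ∎
    where open ≡-Reasoning

  isWord-⟶ : ∀ {w w′} → w ⟶ w′ → IsWord w → IsWord w′
  isWord-⟶ (cancel u v _) uv = All.++⁺ (All.++⁻ˡ u uv) (All.tail (All.tail (All.++⁻ʳ u uv)))

  length-⟶ : ∀ {w w′} → w ⟶ w′ → length w′ ℕ.< length w
  length-⟶ (cancel u v _) = begin-strict
    length (u ++ v)              ≡⟨ List.length-++ u ⟩
    length u + length v          <⟨ ℕ.+-monoʳ-< (length u) (ℕ.m<n⇒m<1+n (ℕ.n<1+n _)) ⟩
    length u + (2 + length v)    ≡⟨ List.length-++ u ⟨
    length (u ++ _ ∷ _ ∷ v)      ∎
    where open ℕ.≤-Reasoning

  ReducedForm : Word → Set
  ReducedForm w = ∃ λ w′ → w ∼ w′ × IsWord w′ × Reduced w′ × value w ≡ value w′ × length w′ ℕ.≤ length w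

  -- Dehn functions only see reduced words. Cancellation shortens a word, so induction on length
  -- applies: if no reduced form existed, every cancellation in `w` would be refuted, and `w` would
  -- already be reduced.
  reducedForm : ∀ w → IsWord w → ¬ ¬ ReducedForm w
  reducedForm w = <-rec P step (length w) w refl
    where
    P : ℕ → Set
    P m = ∀ w → length w ≡ m → IsWord w → ¬ ¬ ReducedForm w
    step : ∀ m → (∀ {k} → k ℕ.< m → P k) → P m
    step _ rec w refl w-isWord none = none (w , Star.ε , w-isWord , reduced , refl , ℕ.≤-refl)
      where
      reduced : Reduced w
      reduced w′ w⟶w′ = rec (length-⟶ w⟶w′) w′ refl (isWord-⟶ w⟶w′ w-isWord)
        λ (w″ , w′∼w″ , w″-isWord , w″-reduced , value≡ , length≤) →
          none (w″ , fwd w⟶w′ Star.◅ w′∼w″ , w″-isWord , w″-reduced , trans (value-⟶ w⟶w′) value≡ ,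
                ℕ.≤-trans length≤ (ℕ.<⇒≤ (length-⟶ w⟶w′)))

  -- A word in `⋃K`, such as the loop over an edge, may contain ε, which is not a letter of the
  -- presentation.
  letters : Word → Word
  letters = filter (λ s → ¬? (s ≟ᴳ ε))

  letters-isWord : ∀ {w} → All ⋃K w → IsWord (letters w)
  letters-isWord {w} w⊆K = All.zip (All.filter⁺ _ w⊆K , All.all-filter _ w)

  value-letters : ∀ w → value (letters w) ≡ value w
  value-letters [] = refl
  value-letters (s ∷ w) with s ≟ᴳ ε
  ... | no  _    = cong (s ∙_) (value-letters w)
  ... | yes refl = trans (value-letters w) (sym (identityˡ _))

  ShortWord : ℕ → Carrier → Set
  ShortWord l g = ∃ λ w → All ⋃K w × value w ≡ g × length w ℕ.≤ l

  -- The presentation yields some word for `g`, so a least length exists under double negation; as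
  -- the length of `g` it is at most `l`.
  shortWord : Presents → ∀ {l} → IsMaxLength l → ∀ g → ¬ ¬ ShortWord l g
  shortWord (onto , _) (_ , max) g none with onto g
  ... | w , w-isWord , value≡ = least-exists (λ k → ∃ λ w → All ⋃K w × value w ≡ g × length w ≡ k) (length w)
    (w , All.map proj₁ w-isWord , value≡ , refl)
    λ { (m , isLength@((w′ , w′⊆K , value′≡ , refl) , _)) → none (w′ , w′⊆K , value′≡ , max m (g , isLength)) }

  -- Double negation commutes with a universal quantifier over a finite list, so one function can
  -- choose words for all elements at once.
  shortWords : Presents → ∀ {l} → IsMaxLength l → ¬ ¬ (∀ g → ShortWord l g)
  shortWords presents {l} max none = ¬¬-∀ elements (λ {g} _ → shortWord presents max g)
    λ all → none (λ g → all (elements-complete g))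
    where
    ¬¬-∀ : ∀ xs → (∀ {g} → g ∈ xs → ¬ ¬ ShortWord l g) → ¬ ¬ (∀ {g} → g ∈ xs → ShortWord l g)
    ¬¬-∀ []       ¬¬P ¬∀ = ¬∀ λ ()
    ¬¬-∀ (x ∷ xs) ¬¬P ¬∀ = ¬¬P (here refl) λ Px → ¬¬-∀ xs (¬¬P ∘ there) λ ∀xs →
      ¬∀ λ { (here refl) → Px ; (there g∈xs) → ∀xs g∈xs }

-- Filling trivial words by triangles

module Filling (G : FiniteGroup) (K : Fin 3 → Subgroup G)
  (e : Fin 3 → Fin 3 → FiniteGroup.Carrier G → Bool) (t : FiniteGroup.Carrier G → Bool) where
  open FiniteGroup G
  open GroupSums G
  open Measure G
  open Subgroup
  open SubgroupPresentation G K
  open Words G K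

  -- A letter lies in some K i, but possibly in several; a fixed choice of i that agrees on
  -- s and s ⁻¹ makes path contributions cancel exactly along free reductions.
  choice : Carrier → Fin 3
  choice s = if does (member? (K zero) s) then zero
             else if does (member? (K (suc zero)) s) then suc zero
             else suc (suc zero)

  choice-⁻¹ : ∀ s → choice (s ⁻¹) ≡ choice s
  choice-⁻¹ s = cong₂ (λ b c → if b then zero else if c then suc zero else suc (suc zero))
                      (does-⁻¹ zero) (does-⁻¹ (suc zero))
    where
    does-⁻¹ : ∀ i → does (member? (K i) (s ⁻¹)) ≡ does (member? (K i) s)
    does-⁻¹ i = does-⇔ (mk⇔ (subst (Member (K i)) (⁻¹-involutive s) ∘ ⁻¹-closed (K i)) (⁻¹-closed (K i)))
                       (member? (K i) (s ⁻¹)) (member? (K i) s)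

  choice-member : ∀ {s} → ⋃K s → Member (K (choice s)) s
  choice-member {s} s∈⋃K with member? (K zero) s | member? (K (suc zero)) s
  ... | yes p | _     = p
  ... | no  _ | yes p = p
  choice-member (zero         , p) | no ¬p | no _  = contradiction p ¬p
  choice-member (suc zero     , p) | no _  | no ¬p = contradiction p ¬p
  choice-member (suc (suc zero) , p) | no _ | no _ = p

  -- `e i j g` stands for the value of an edge cochain between `gKᵢ` and `gKⱼ`, and `t g` for its
  -- coboundary on the triangle of `g`. Spokes are the edges at `gK₀`.
  spoke : Fin 3 → Carrier → Bool
  spoke = e zero

  detour : Fin 3 → Carrier → Carrier → Bool
  detour i s g = spoke i g xor spoke i (g ∙ s)

  -- The sum of e along the edge path gK₀, gKᵢ = gsKᵢ, gsK₀, ... spelled by a word from g.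
  along : Carrier → Word → Bool
  along g []      = false
  along g (s ∷ w) = detour (choice s) s g xor along (g ∙ s) w

  along-++ : ∀ g u v → along g (u ++ v) ≡ along g u xor along (g ∙ value u) v
  along-++ g []      v = cong (λ h → along h v) (sym (identityʳ g))
  along-++ g (s ∷ u) v = begin
    a xor along (g ∙ s) (u ++ v)
      ≡⟨ cong (a xor_) (along-++ (g ∙ s) u v) ⟩
    a xor (along (g ∙ s) u xor along (g ∙ s ∙ value u) v)
      ≡⟨ Bool.xor-assoc a _ _ ⟨
    (a xor along (g ∙ s) u) xor along (g ∙ s ∙ value u) v
      ≡⟨ cong (λ h → (a xor along (g ∙ s) u) xor along h v) (assoc g s (value u)) ⟩
    (a xor along (g ∙ s) u) xor along (g ∙ (s ∙ value u)) v ∎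
    where
    open ≡-Reasoning
    a = detour (choice s) s g

  detour-⁻¹ : ∀ g s → detour (choice (s ⁻¹)) (s ⁻¹) (g ∙ s) ≡ detour (choice s) s g
  detour-⁻¹ g s = begin
    spoke (choice (s ⁻¹)) (g ∙ s) xor spoke (choice (s ⁻¹)) (g ∙ s ∙ s ⁻¹)
      ≡⟨ cong₂ (λ i h → spoke i (g ∙ s) xor spoke i h) (choice-⁻¹ s) g∙s∙s⁻¹≡g ⟩
    spoke (choice s) (g ∙ s) xor spoke (choice s) g
      ≡⟨ Bool.xor-comm (spoke (choice s) (g ∙ s)) _ ⟩
    spoke (choice s) g xor spoke (choice s) (g ∙ s) ∎
    where
    open ≡-Reasoning
    g∙s∙s⁻¹≡g : g ∙ s ∙ s ⁻¹ ≡ g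
    g∙s∙s⁻¹≡g = trans (assoc g s (s ⁻¹)) (trans (cong (g ∙_) (inverseʳ s)) (identityʳ g))

  along-cancel : ∀ g s v → along g (s ∷ s ⁻¹ ∷ v) ≡ along g v
  along-cancel g s v = begin
    a xor (detour (choice (s ⁻¹)) (s ⁻¹) (g ∙ s) xor along (g ∙ s ∙ s ⁻¹) v)
      ≡⟨ cong₂ (λ b h → a xor (b xor along h v)) (detour-⁻¹ g s)
           (trans (assoc g s (s ⁻¹)) (trans (cong (g ∙_) (inverseʳ s)) (identityʳ g))) ⟩
    a xor (a xor along g v)
      ≡⟨ Bool.xor-assoc a a _ ⟨
    (a xor a) xor along g v
      ≡⟨ cong (_xor along g v) (Bool.xor-same a) ⟩
    along g v ∎
    where
    open ≡-Reasoning
    a = detour (choice s) s g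

  along-⟶ : ∀ g {w w′} → w ⟶ w′ → along g w ≡ along g w′
  along-⟶ g (cancel u {s} v _) = begin
    along g (u ++ s ∷ s ⁻¹ ∷ v)                          ≡⟨ along-++ g u _ ⟩
    along g u xor along (g ∙ value u) (s ∷ s ⁻¹ ∷ v)     ≡⟨ cong (along g u xor_) (along-cancel (g ∙ value u) s v) ⟩
    along g u xor along (g ∙ value u) v                  ≡⟨ along-++ g u v ⟨
    along g (u ++ v)                                     ∎
    where open ≡-Reasoning

  -- This makes `along g` well defined on Free(S), where areas are measured.
  along-∼ : ∀ g {w w′} → w ∼ w′ → along g w ≡ along g w′
  along-∼ g = gfold isEquivalence (along g) (along-⟶ g)

  along-inverse : ∀ g w → along (g ∙ value w) (inverse w) ≡ along g w
  along-inverse g []      = refl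
  along-inverse g (s ∷ w) = begin
    along (g ∙ (s ∙ value w)) (inverse (s ∷ w))
      ≡⟨ cong₂ along (sym (assoc g s (value w))) (inverse-∷ s w) ⟩
    along (g ∙ s ∙ value w) (inverse w ++ [ s ⁻¹ ])
      ≡⟨ along-++ (g ∙ s ∙ value w) (inverse w) [ s ⁻¹ ] ⟩
    along (g ∙ s ∙ value w) (inverse w) xor along (g ∙ s ∙ value w ∙ value (inverse w)) [ s ⁻¹ ]
      ≡⟨ cong₂ (λ b h → b xor along h [ s ⁻¹ ]) (along-inverse (g ∙ s) w) back ⟩
    along (g ∙ s) w xor (detour (choice (s ⁻¹)) (s ⁻¹) (g ∙ s) xor false)
      ≡⟨ cong (along (g ∙ s) w xor_) (trans (Bool.xor-identityʳ _) (detour-⁻¹ g s)) ⟩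
    along (g ∙ s) w xor detour (choice s) s g
      ≡⟨ Bool.xor-comm (along (g ∙ s) w) _ ⟩
    detour (choice s) s g xor along (g ∙ s) w ∎
    where
    open ≡-Reasoning
    back : g ∙ s ∙ value w ∙ value (inverse w) ≡ g ∙ s
    back = trans (cong (g ∙ s ∙ value w ∙_) (value-inverse w))
      (trans (assoc (g ∙ s) (value w) _) (trans (cong (g ∙ s ∙_) (inverseʳ (value w))) (identityʳ _)))

  -- The letter ε goes out and back along the same edge, which is 0 mod 2.
  along-letters : ∀ g w → along g (letters w) ≡ along g w
  along-letters g [] = refl
  along-letters g (s ∷ w) with s ≟ᴳ ε
  ... | no  _    = cong (detour (choice s) s g xor_) (along-letters (g ∙ s) w)
  ... | yes refl = begin
    along g (letters w)                    ≡⟨ along-letters g w ⟩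
    along g w                              ≡⟨ cong (_xor along g w) (Bool.xor-same a) ⟨
    (a xor a) xor along g w                ≡⟨ cong (λ h → (a xor spoke (choice ε) h) xor along h w) (identityʳ g) ⟨
    (a xor spoke (choice ε) (g ∙ ε)) xor along (g ∙ ε) w ∎
    where
    open ≡-Reasoning
    a = spoke (choice ε) g

  module Bounds
    (e-invariant : ∀ i j g {k} → Member (K i) k → Member (K j) k → e i j (g ∙ k) ≡ e i j g)
    (triangle-bound : ∀ i j g → ⟦ e i j g xor (spoke i g xor spoke j g) ⟧ ℕ.≤ ⟦ t g ⟧) where

    τ : ℕ
    τ = μ t

    -- The sum around the triangle `gK₀`, `gKᵢ`, `gKⱼ`, which may be degenerate.
    triangle : Fin 3 → Fin 3 → Carrier → Bool
    triangle i j g = e i j g xor (spoke i g xor spoke j g)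

    μ-triangle : ∀ i j x → μ (λ g → triangle i j (g ∙ x)) ℕ.≤ τ
    μ-triangle i j x = ℕ.≤-trans (ℕ.≤-reflexive (μ-translate x (triangle i j))) (μ-mono (triangle-bound i j))

    -- The edge gKᵢ, gKₖ shared by the triangles at g and at gs makes them fill the difference of two detours.
    μ-detour : ∀ i s x → Member (K i) s →
               μ (λ g → detour (choice s) s (g ∙ x) xor detour i s (g ∙ x)) ℕ.≤ τ + τ
    μ-detour i s x s∈K = begin
      μ (λ g → detour k s (g ∙ x) xor detour i s (g ∙ x))
        ≡⟨ μ-cong (λ g → trans (rearrange (spoke k (g ∙ x)) (spoke k (g ∙ x ∙ s))
                                             (spoke i (g ∙ x)) (spoke i (g ∙ x ∙ s)) (e i k (g ∙ x)))
             (cong₂ (λ b h → triangle i k (g ∙ x) xor (b xor (spoke i h xor spoke k h)))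
                    (trans (sym (e-invariant i k (g ∙ x) s∈K (choice-member (i , s∈K)))) (cong (e i k) (assoc g x s)))
                    (assoc g x s))) ⟩
      μ (λ g → triangle i k (g ∙ x) xor triangle i k (g ∙ (x ∙ s)))
        ≤⟨ μ-xor-≤ (λ g → triangle i k (g ∙ x)) (λ g → triangle i k (g ∙ (x ∙ s)))
             (μ-triangle i k x) (μ-triangle i k (x ∙ s)) ⟩
      τ + τ ∎
      where
      open ℕ.≤-Reasoning
      k = choice s
      rearrange : ∀ a a′ b b′ c → (a xor a′) xor (b xor b′) ≡ (c xor (b xor a)) xor (c xor (b′ xor a′))
      rearrange = solve 5 (λ a a′ b b′ c → (a :+ a′) :+ (b :+ b′) := (c :+ (b :+ a)) :+ (c :+ (b′ :+ a′))) refl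
        where open xor-∧-Solver

    -- With all three letters routed through the common `Kᵢ`, the spokes telescope to 0 because the
    -- loop closes up. The only cost is the switch from `choice` to `i`, two triangles for each
    -- letter.
    μ-relator : ∀ {w} → ⋃R w → μ (λ g → along g w) ℕ.≤ 6 * τ
    μ-relator (i , g₁ , g₂ , g₃ , (g₁∈K , _) , (g₂∈K , _) , (g₃∈K , _) , g₁g₂g₃≡ε , refl) = begin
      μ (λ g → along g (g₁ ∷ g₂ ∷ g₃ ∷ []))
        ≡⟨ μ-cong along≡ ⟩
      μ (λ g → difference g₁ (g ∙ ε) xor (difference g₂ (g ∙ g₁) xor difference g₃ (g ∙ (g₁ ∙ g₂))))
        ≤⟨ μ-xor-≤ (λ g → difference g₁ (g ∙ ε)) (λ g → difference g₂ (g ∙ g₁) xor difference g₃ (g ∙ (g₁ ∙ g₂)))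
             (μ-detour i g₁ ε g₁∈K)
             (μ-xor-≤ (λ g → difference g₂ (g ∙ g₁)) (λ g → difference g₃ (g ∙ (g₁ ∙ g₂)))
               (μ-detour i g₂ g₁ g₂∈K) (μ-detour i g₃ (g₁ ∙ g₂) g₃∈K)) ⟩
      (τ + τ) + ((τ + τ) + (τ + τ))
        ≡⟨ solve 1 (λ τ → (τ :+ τ) :+ ((τ :+ τ) :+ (τ :+ τ)) := con 6 :* τ) refl τ ⟩
      6 * τ ∎
      where
      open ℕ.≤-Reasoning
      open +-*-Solver
      difference : Carrier → Carrier → Bool
      difference s g = detour (choice s) s g xor detour i s g
      closed : ∀ g → g ∙ g₁ ∙ g₂ ∙ g₃ ≡ g
      closed g = trans (trans (cong (_∙ g₃) (assoc g g₁ g₂)) (assoc g (g₁ ∙ g₂) g₃))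
                       (trans (cong (g ∙_) g₁g₂g₃≡ε) (identityʳ g))
      telescope : ∀ a b c x y z → a xor (b xor (c xor false)) ≡
                  (a xor (x xor y)) xor ((b xor (y xor z)) xor (c xor (z xor x)))
      telescope = X.solve 6 (λ a b c x y z → a X.:+ (b X.:+ (c X.:+ X.con false)) X.:=
                    (a X.:+ (x X.:+ y)) X.:+ ((b X.:+ (y X.:+ z)) X.:+ (c X.:+ (z X.:+ x)))) refl
        where module X = xor-∧-Solver
      along≡ : ∀ g → along g (g₁ ∷ g₂ ∷ g₃ ∷ []) ≡
               difference g₁ (g ∙ ε) xor (difference g₂ (g ∙ g₁) xor difference g₃ (g ∙ (g₁ ∙ g₂)))
      along≡ g rewrite identityʳ g | sym (assoc g g₁ g₂) | closed g =
        telescope (detour (choice g₁) g₁ g) (detour (choice g₂) g₂ (g ∙ g₁))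
          (spoke (choice g₃) (g ∙ g₁ ∙ g₂) xor spoke (choice g₃) g) (spoke i g) (spoke i (g ∙ g₁)) (spoke i (g ∙ g₁ ∙ g₂))

    value-relator : ∀ {w} → ⋃R w → value w ≡ ε
    value-relator (_ , g₁ , g₂ , g₃ , _ , _ , _ , g₁g₂g₃≡ε , refl) =
      trans (cong (λ h → g₁ ∙ (g₂ ∙ h)) (identityʳ g₃)) (trans (sym (assoc g₁ g₂ g₃)) g₁g₂g₃≡ε)

    relator± : ∀ {w} → ⋃R w ⊎ (∃ λ w′ → ⋃R w′ × w ≡ inverse w′) → value w ≡ ε × μ (λ g → along g w) ℕ.≤ 6 * τ
    relator± (inj₁ w∈R) = value-relator w∈R , μ-relator w∈R
    relator± (inj₂ (w , w∈R , refl)) =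
      trans (value-inverse w) (trans (cong _⁻¹ (value-relator w∈R)) ε⁻¹≈ε) ,
      ℕ.≤-trans (ℕ.≤-reflexive (μ-cong λ g → trans (cong (λ h → along h (inverse w)) (g≡ g)) (along-inverse g w)))
              (μ-relator w∈R)
      where
      g≡ : ∀ g → g ≡ g ∙ value w
      g≡ g = sym (trans (cong (g ∙_) (value-relator w∈R)) (identityʳ g))

    -- The two copies of u cancel mod 2, so the lengths of conjugators do not matter.
    along-conjugate : ∀ g u w → value w ≡ ε → along g (inverse u ++ w ++ u) ≡ along (g ∙ value u ⁻¹) w
    along-conjugate g u w w≡ε = begin
      along g (inverse u ++ w ++ u)
        ≡⟨ along-++ g (inverse u) (w ++ u) ⟩
      along g (inverse u) xor along (g ∙ value (inverse u)) (w ++ u)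
        ≡⟨ cong₂ (λ h k → along h (inverse u) xor along (g ∙ k) (w ++ u)) (sym (y∙x⁻¹∙x (value u))) (value-inverse u) ⟩
      along (x ∙ value u) (inverse u) xor along x (w ++ u)
        ≡⟨ cong₂ _xor_ (along-inverse x u) (along-++ x w u) ⟩
      along x u xor (along x w xor along (x ∙ value w) u)
        ≡⟨ cong (λ h → along x u xor (along x w xor along h u)) (trans (cong (x ∙_) w≡ε) (identityʳ x)) ⟩
      along x u xor (along x w xor along x u)
        ≡⟨ solve 2 (λ a b → a :+ (b :+ a) := b) refl (along x u) (along x w) ⟩
      along x w ∎
      where
      open ≡-Reasoning
      open xor-∧-Solver
      x = g ∙ value u ⁻¹
      y∙x⁻¹∙x : ∀ h → g ∙ h ⁻¹ ∙ h ≡ g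
      y∙x⁻¹∙x h = [y∙x⁻¹]∙x≡y h g

    filled-bound : ∀ {a} (cs : Vec.Vec Conjugate a) →
      μ (λ g → along g (concat (map Conjugate.conjugate (Vec.toList cs)))) ℕ.≤ a * (6 * τ)
    filled-bound Vec.[] = ℕ.≤-reflexive μ-false
    filled-bound {suc a} (c Vec.∷ cs) = begin
      μ (λ g → along g (conjugate ++ rest))
        ≡⟨ μ-cong (λ g → trans (along-++ g conjugate rest)
             (cong₂ _xor_ (along-conjugate g u r (proj₁ (relator± r∈R±)))
                         (cong (λ h → along h rest) (trans (cong (g ∙_) conjugate≡ε) (identityʳ g))))) ⟩
      μ (λ g → along (g ∙ value u ⁻¹) r xor along g rest)
        ≤⟨ μ-xor-≤ (λ g → along (g ∙ value u ⁻¹) r) (λ g → along g rest)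
             (ℕ.≤-trans (ℕ.≤-reflexive (μ-translate (value u ⁻¹) (λ g → along g r))) (proj₂ (relator± r∈R±)))
             (filled-bound cs) ⟩
      suc a * (6 * τ) ∎
      where
      open ℕ.≤-Reasoning
      open Conjugate c
      rest : Word
      rest = concat (map Conjugate.conjugate (Vec.toList cs))
      conjugate≡ε : value conjugate ≡ ε
      conjugate≡ε = ≡.begin
        value (inverse u ++ r ++ u)                ≡.≡⟨ value-++ (inverse u) (r ++ u) ⟩
        value (inverse u) ∙ value (r ++ u)         ≡.≡⟨ cong₂ _∙_ (value-inverse u) (value-++ r u) ⟩
        value u ⁻¹ ∙ (value r ∙ value u)           ≡.≡⟨ cong (λ h → value u ⁻¹ ∙ (h ∙ value u)) (proj₁ (relator± r∈R±)) ⟩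
        value u ⁻¹ ∙ (ε ∙ value u)                 ≡.≡⟨ cong (value u ⁻¹ ∙_) (identityˡ _) ⟩
        value u ⁻¹ ∙ value u                       ≡.≡⟨ inverseˡ _ ⟩
        ε                                          ≡.∎
        where module ≡ = ≡-Reasoning

    -- Dropping ε and reducing freely preserve `along g` and do not lengthen the word, so they lead
    -- to a word over which `D m` is a maximum. Its area counts relators, each at cost at most
    -- `6 * τ`.
    loop-bound : Presents → ∀ {D} → IsDehn D → ∀ {w} m → All ⋃K w → value w ≡ ε → length w ℕ.≤ m →
                 μ (λ g → along g w) ℕ.≤ D m * (6 * τ)
    loop-bound (_ , trivial) {D} isDehn {w} m w⊆K w≡ε length≤ = decidable-stable (_ ℕ.≤? _) λ ¬bound →
      reducedForm (letters w) (letters-isWord w⊆K) λ (w′ , w∼w′ , w′-isWord , w′-reduced , value≡ , length′≤) →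
      let w′≡ε = trans (sym value≡) (trans (value-letters w) w≡ε)
          n , filled = Equivalence.to (trivial w′ w′-isWord) w′≡ε
      in least-exists (FilledBy w′) n filled λ (a , area@((cs , w′∼) , _)) → ¬bound (begin
        μ (λ g → along g w)
          ≡⟨ μ-cong (λ g → trans (sym (along-letters g w)) (trans (along-∼ g w∼w′) (along-∼ g w′∼))) ⟩
        μ (λ g → along g (concat (map Conjugate.conjugate (Vec.toList cs))))
          ≤⟨ filled-bound cs ⟩
        a * (6 * τ)
          ≤⟨ ℕ.*-monoˡ-≤ (6 * τ) (proj₂ (isDehn m) a (w′ , w′-isWord , w′-reduced , w′≡ε ,
               ℕ.≤-trans length′≤ (ℕ.≤-trans (List.length-filter _ w) length≤) , area)) ⟩
        D m * (6 * τ) ∎)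
      where open ℕ.≤-Reasoning

    module Cone {l} (short : ∀ g → ShortWord l g) where

      -- The sum of e along the translate by g of a path from K₀ to yKᵢ.
      cone : Carrier → Fin 3 → Carrier → Bool
      cone g i y = along g (proj₁ (short y)) xor spoke i (g ∙ y)

      -- `y` and `z` represent the cosets `xKᵢ` and `xKⱼ`. The triangle at `x` trades the base edge
      -- for two spokes; switching the letters from `y` to `x` and from `x` to `z` between their
      -- types `i`, `j` and `choice` costs two triangles each. What remains is the sum along the
      -- trivial word `loop`.
      cone-bound : Presents → ∀ {D} → IsDehn D → ∀ i j x y z →
        Member (K i) (y ⁻¹ ∙ x) → Member (K j) (x ⁻¹ ∙ z) →
        μ (λ g → e i j (g ∙ x) xor (cone g i y xor cone g j z)) ℕ.≤ (5 + D (2 * (1 + l) + 1) * 6) * τ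
      cone-bound presents {D} isDehn i j x y z y⁻¹x∈K x⁻¹z∈K = begin
        μ (λ g → e i j (g ∙ x) xor (cone g i y xor cone g j z))
          ≡⟨ μ-cong split ⟩
        μ (λ g → triangle i j (g ∙ x) xor (difference i a (g ∙ y) xor (difference j b (g ∙ x) xor along g loop)))
          ≤⟨ μ-xor-≤ (λ g → triangle i j (g ∙ x)) (λ g → difference i a (g ∙ y) xor (difference j b (g ∙ x) xor along g loop))
               (μ-triangle i j x)
             (μ-xor-≤ (λ g → difference i a (g ∙ y)) (λ g → difference j b (g ∙ x) xor along g loop)
               (μ-detour i a y y⁻¹x∈K)
             (μ-xor-≤ (λ g → difference j b (g ∙ x)) (λ g → along g loop)
               (μ-detour j b x x⁻¹z∈K)
               (loop-bound presents isDehn M loop⊆K loop≡ε length≤))) ⟩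
        τ + ((τ + τ) + ((τ + τ) + D M * (6 * τ)))
          ≡⟨ solve 2 (λ τ D → τ :+ ((τ :+ τ) :+ ((τ :+ τ) :+ D :* (con 6 :* τ))) :=
                           (con 5 :+ D :* con 6) :* τ) refl τ (D M) ⟩
        (5 + D M * 6) * τ ∎
        where
        open ℕ.≤-Reasoning
        open +-*-Solver
        M : ℕ
        M = 2 * (1 + l) + 1
        a b : Carrier
        a = y ⁻¹ ∙ x
        b = x ⁻¹ ∙ z
        u v loop : Word
        u = proj₁ (short y)
        v = proj₁ (short z)
        loop = u ++ a ∷ b ∷ inverse v
        value-u : value u ≡ y
        value-u = proj₁ (proj₂ (proj₂ (short y)))
        value-v : value v ≡ z
        value-v = proj₁ (proj₂ (proj₂ (short z)))
        difference : Fin 3 → Carrier → Carrier → Bool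
        difference i s g = detour (choice s) s g xor detour i s g
        loop⊆K : All ⋃K loop
        loop⊆K = All.++⁺ (proj₁ (proj₂ (short y)))
          ((i , y⁻¹x∈K) ∷ (j , x⁻¹z∈K) ∷ inverse⊆⋃K (proj₁ (proj₂ (short z))))
        loop≡ε : value loop ≡ ε
        loop≡ε = trans (value-++ u _) (trans (cong₂ _∙_ value-u
          (cong (λ h → a ∙ (b ∙ h)) (trans (value-inverse v) (cong _⁻¹ value-v))))
          (trans (cong (y ∙_) (assoc (y ⁻¹) x _)) (trans (x∙[x⁻¹∙y]≡y y _)
            (trans (cong (x ∙_) (assoc (x ⁻¹) z (z ⁻¹))) (trans (x∙[x⁻¹∙y]≡y x _) (inverseʳ z))))))
        -- Two words of length at most `l` and the letters `a` and `b` make at most 2l + 2, one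
        -- below `M`.
        length≤ : length loop ℕ.≤ M
        length≤ = begin
          length loop                        ≡⟨ List.length-++ u ⟩
          length u + (2 + length (inverse v)) ≡⟨ cong (λ k → length u + (2 + k)) (length-inverse v) ⟩
          length u + (2 + length v)          ≤⟨ ℕ.+-mono-≤ (proj₂ (proj₂ (proj₂ (short y))))
                                                                 (ℕ.+-monoʳ-≤ 2 (proj₂ (proj₂ (proj₂ (short z))))) ⟩
          l + (2 + l)                        ≤⟨ ℕ.m≤m+n (l + (2 + l)) 1 ⟩
          l + (2 + l) + 1
            ≡⟨ solve 1 (λ l → l :+ (con 2 :+ l) :+ con 1 := con 2 :* (con 1 :+ l) :+ con 1) refl l ⟩
          M                                  ∎
        along-loop : ∀ g → along g loop ≡
          along g u xor (detour (choice a) a (g ∙ y) xor (detour (choice b) b (g ∙ x) xor along g v))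
        along-loop g = trans (along-++ g u _) (cong (along g u xor_)
          (trans (cong (λ h → along (g ∙ h) (a ∷ b ∷ inverse v)) value-u)
          (cong₂ _xor_ (refl {x = detour (choice a) a (g ∙ y)})
          (trans (cong (λ h → along h (b ∷ inverse v)) (to-x g))
          (cong₂ _xor_ (refl {x = detour (choice b) b (g ∙ x)})
          (trans (cong (λ h → along h (inverse v)) (trans (to-z g) (cong (g ∙_) (sym value-v)))) (along-inverse g v)))))))
          where
          to-x : ∀ g → g ∙ y ∙ a ≡ g ∙ x
          to-x g = trans (assoc g y a) (cong (g ∙_) (x∙[x⁻¹∙y]≡y y x))
          to-z : ∀ g → g ∙ x ∙ b ≡ g ∙ z
          to-z g = trans (assoc g x b) (cong (g ∙_) (x∙[x⁻¹∙y]≡y x z))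
        split : ∀ g → e i j (g ∙ x) xor (cone g i y xor cone g j z) ≡
          triangle i j (g ∙ x) xor (difference i a (g ∙ y) xor (difference j b (g ∙ x) xor along g loop))
        split g rewrite along-loop g | assoc g y a | x∙[x⁻¹∙y]≡y y x | assoc g x b | x∙[x⁻¹∙y]≡y x z =
          -- On the right `A`, `B′`, `ix` and `jx` occur twice each and vanish mod 2.
          X.solve 9 (λ E U V A B′ iy ix jx jz →
            E X.:+ ((U X.:+ iy) X.:+ (V X.:+ jz)) X.:=
            (E X.:+ (ix X.:+ jx)) X.:+
            ((A X.:+ (iy X.:+ ix)) X.:+ ((B′ X.:+ (jx X.:+ jz)) X.:+ (U X.:+ (A X.:+ (B′ X.:+ V))))))
            refl (e i j (g ∙ x)) (along g u) (along g v)
            (spoke (choice a) (g ∙ y) xor spoke (choice a) (g ∙ x))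
            (spoke (choice b) (g ∙ x) xor spoke (choice b) (g ∙ z))
            (spoke i (g ∙ y)) (spoke i (g ∙ x)) (spoke j (g ∙ x)) (spoke j (g ∙ z))
          where module X = xor-∧-Solver

-- Cochains on the standard triangle

vanishing : ∀ {b n} → b ≡ false → ⟦ b ⟧ ℕ.≤ n
vanishing refl = z≤n

xor-cancel : ∀ a → a xor (a xor false) ≡ false
xor-cancel a = trans (cong (a xor_) (Bool.xor-identityʳ a)) (Bool.xor-same a)

xor-rotate : ∀ a b c → a xor (b xor c) ≡ b xor (c xor (a xor false))
xor-rotate = solve 3 (λ a b c → a :+ (b :+ c) := b :+ (c :+ (a :+ con false))) refl
  where open xor-∧-Solver

xor-false : ∀ a b → a xor (b xor false) ≡ a xor b
xor-false a b = cong (a xor_) (Bool.xor-identityʳ b)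

xor-false-comm : ∀ a b → a xor (b xor false) ≡ b xor a
xor-false-comm a b = trans (xor-false a b) (Bool.xor-comm a b)

module Triangle where
  open Cohomology (standardSimplex 3) 2
  open Faces (standardSimplex 3) 2

  corner : Fin 3 → Face 1
  corner i = face ⁅ i ⁆ (tt , ∣⁅x⁆∣≡1 i)

  edge : ∀ i j → i ≢ j → Face 2
  edge i j i≢j = face (⁅ i ⁆ ∪ ⁅ j ⁆) (tt , card i j i≢j)
    where
    card? : Dec (∀ (i j : Fin 3) → i ≢ j → ∣ ⁅ i ⁆ ∪ ⁅ j ⁆ ∣ ≡ 2)
    card? = Fin.all? λ i → Fin.all? λ j → ¬? (i Fin.≟ j) →-dec (∣ ⁅ i ⁆ ∪ ⁅ j ⁆ ∣ ℕ.≟ 2)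
    card : ∀ i j → i ≢ j → ∣ ⁅ i ⁆ ∪ ⁅ j ⁆ ∣ ≡ 2
    card = from-yes card?

  full : Face 3
  full = face ⊤ (tt , refl)

  -- Extended by 0 to equal types, because the types met along a path may coincide with each other
  -- or with `zero`; degenerate triangles then obey the same bounds as genuine ones.
  side : Cochain 2 → Fin 3 → Fin 3 → Bool
  side c i j with i Fin.≟ j
  ... | yes _  = false
  ... | no i≢j = c (edge i j i≢j)

  side-cong : ∀ {c c′} i j → (∀ i≢j → c (edge i j i≢j) ≡ c′ (edge i j i≢j)) → side c i j ≡ side c′ i j
  side-cong i j eq with i Fin.≟ j
  ... | yes _  = refl
  ... | no i≢j = eq i≢j

  side-≤ : ∀ c i j → ⟦ side c i j ⟧ ℕ.≤ ∑ (faces 2) (⟦_⟧ ∘ c)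
  side-≤ c i j with i Fin.≟ j
  ... | yes _  = z≤n
  ... | no i≢j = ∈⇒≤∑ (⟦_⟧ ∘ c) (faces-complete (edge i j i≢j))

  -- For concrete `i` and `j` the coboundary evaluates, listing corners in increasing order; hence
  -- the commutation when `i` exceeds `j`.
  d-edge : (h : Cochain 1) → ∀ i j i≢j → d h (edge i j i≢j) ≡ h (corner i) xor h (corner j)
  d-edge h zero             zero             i≢j = contradiction refl i≢j
  d-edge h (suc zero)       (suc zero)       i≢j = contradiction refl i≢j
  d-edge h (suc (suc zero)) (suc (suc zero)) i≢j = contradiction refl i≢j
  d-edge h zero             (suc zero)       _ = xor-false (h (corner zero)) (h (corner (suc zero)))
  d-edge h zero             (suc (suc zero)) _ = xor-false (h (corner zero)) (h (corner (suc (suc zero))))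
  d-edge h (suc zero)       (suc (suc zero)) _ = xor-false (h (corner (suc zero))) (h (corner (suc (suc zero))))
  d-edge h (suc zero)       zero             _ = xor-false-comm (h (corner zero)) (h (corner (suc zero)))
  d-edge h (suc (suc zero)) zero             _ = xor-false-comm (h (corner zero)) (h (corner (suc (suc zero))))
  d-edge h (suc (suc zero)) (suc zero)       _ = xor-false-comm (h (corner (suc zero))) (h (corner (suc (suc zero))))

  side-d : (h : Cochain 1) → ∀ i j → side (d h) i j ≡ h (corner i) xor h (corner j)
  side-d h i j with i Fin.≟ j
  ... | yes refl = sym (Bool.xor-same (h (corner i)))
  ... | no i≢j   = d-edge h i j i≢j

  -- If `zero`, `i` and `j` are distinct, the sum runs once around the triangle; otherwise its terms
  -- vanish or cancel in pairs.
  side-triangle : ∀ c i j → ⟦ side c i j xor (side c zero i xor side c zero j) ⟧ ℕ.≤ ⟦ d c full ⟧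
  side-triangle c zero               zero               = z≤n
  side-triangle c zero             j@(suc zero)         = vanishing (Bool.xor-same (side c zero j))
  side-triangle c zero             j@(suc (suc zero))   = vanishing (Bool.xor-same (side c zero j))
  side-triangle c i@(suc zero)       zero               = vanishing (xor-cancel (side c i zero))
  side-triangle c i@(suc (suc zero)) zero               = vanishing (xor-cancel (side c i zero))
  side-triangle c i@(suc zero)       (suc zero)         = vanishing (Bool.xor-same (side c zero i))
  side-triangle c i@(suc (suc zero)) (suc (suc zero))   = vanishing (Bool.xor-same (side c zero i))
  side-triangle c i@(suc zero)       j@(suc (suc zero)) = ℕ.≤-reflexive (cong ⟦_⟧
    (xor-rotate (side c i j) (side c zero i) (side c zero j)))
  side-triangle c i@(suc (suc zero)) j@(suc zero)       = ℕ.≤-reflexive (cong ⟦_⟧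
    (trans (cong (side c i j xor_) (Bool.xor-comm (side c zero i) (side c zero j)))
           (xor-rotate (side c i j) (side c zero j) (side c zero i))))

-- Distance to coboundaries in degrees 0 and 1

module Expansion (G : FiniteGroup) (K : Fin 3 → Subgroup G) (transitive : CosetComplex.TransitiveOn G K 2) where
  open FiniteGroup G
  open GroupSums G
  open Measure G
  open Subgroup
  open CosetComplex G K
  open Cohomology complex 2
  open Faces complex 2
  open Weights complex 2
  open Complex G 2 K
  open Averaging G 2 K transitive
  open SubgroupPresentation G K
  open Words G K
  open Triangle using (corner; edge; side; side-cong; side-≤; side-d; d-edge; side-triangle)

  denominator>0 : 0 ℕ.< denominator 1 × 0 ℕ.< denominator 2 × 0 ℕ.< denominator 3
  denominator>0 = ℕ.*-mono-≤ {1} {3} (s≤s z≤n) faces>0 ,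
                  ℕ.*-mono-≤ {1} {3} (s≤s z≤n) faces>0 ,
                  ℕ.*-mono-≤ {1} {1} (s≤s z≤n) faces>0

  module Connectivity {l} (short : ∀ g → ShortWord l g) (φ : Cochain 1) where

    f : Fin 3 → Carrier → Bool
    f i g = φ (F g (corner i))

    f-invariant : ∀ i g {k} → Member (K i) k → f i (g ∙ k) ≡ f i g
    f-invariant i g k∈K = cong φ (F-cong (corner i) λ j∈ →
      subst (λ j → g ∙ _ ≈[ j ] g) (sym (x∈⁅y⁆⇒x≡y i j∈)) (≈-sym i (≈-∙ i g k∈K)))

    ν : ℕ
    ν = stabiliserOrder * mass (d φ)

    -- `mass-orbit` expands `ν` as a count over all three edges of each `F g chamber`, which
    -- dominates the count over any one of them.
    ν-bound : ∀ i j → μ (λ g → f i g xor f j g) ℕ.≤ ν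
    ν-bound i j = begin
      μ (λ g → f i g xor f j g)
        ≡⟨ μ-cong (λ g → trans (sym (side-d (φ ∘ F g) i j)) (side-cong i j λ i≢j → sym (d-F φ g (edge i j i≢j)))) ⟩
      μ (λ g → side (d φ ∘ F g) i j)
        ≤⟨ ∑-mono elements (λ g → side-≤ (d φ ∘ F g) i j) ⟩
      ∑ elements (λ g → ∑ (Cohomology.faces (standardSimplex 3) 2 2) λ B → ⟦ d φ (F g B) ⟧)
        ≡⟨ mass-orbit (d φ) ⟨
      ν ∎
      where open ℕ.≤-Reasoning

    -- Constants are the coboundaries in degree 0, coming from the empty face. The value taken is
    -- that of `φ` at the apex `gK₀`.
    constant : Carrier → Cochain 1
    constant g = d (λ _ → f zero g)

    boundAlong : ∀ i {w} → All ⋃K w → length w ℕ.≤ l →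
                 μ (λ g → (φ +ᶜ constant g) (F (g ∙ value w) (corner i))) ℕ.≤ (1 + l) * ν
    boundAlong i {w} w⊆K length≤ = begin
      μ (λ g → f i (g ∙ value w) xor constant g (F (g ∙ value w) (corner i)))
        ≡⟨ μ-cong (λ g → trans (cong (f i (g ∙ value w) xor_)
                                 (trans (d-F _ (g ∙ value w) (corner i)) (d-constant i (f zero g))))
                               (Bool.xor-comm (f i (g ∙ value w)) (f zero g))) ⟩
      μ (λ g → f zero g xor f i (g ∙ value w))
        ≤⟨ Paths.Variation.variation G K f f-invariant ν ν-bound w⊆K zero i ⟩
      (1 + length w) * ν
        ≤⟨ ℕ.*-monoˡ-≤ ν (s≤s length≤) ⟩
      (1 + l) * ν ∎
      where
      open ℕ.≤-Reasoning
      d-constant : ∀ i c → Cohomology.d (standardSimplex 3) 2 (λ _ → c) (corner i) ≡ c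
      d-constant zero             c = Bool.xor-identityʳ c
      d-constant (suc zero)       c = Bool.xor-identityʳ c
      d-constant (suc (suc zero)) c = Bool.xor-identityʳ c

    bound : ∀ i x → μ (λ g → (φ +ᶜ constant g) (F (g ∙ x) (corner i))) ℕ.≤ (1 + l) * ν
    bound i x = let w , w⊆K , value≡ , length≤ = short x in
      subst (λ y → μ (λ g → (φ +ᶜ constant g) (F (g ∙ y) (corner i))) ℕ.≤ (1 + l) * ν) value≡
        (boundAlong i w⊆K length≤)

    distance : ∀ {m} → IsDistanceToB φ m → m ≤ fromℕ (3 * (1 + l)) ℚ.* ∥ d φ ∥
    -- The factor 3 counts the vertices of a chamber. The two denominators agree, since 3 C 1 = 3 C
    -- 2.
    distance = distance-≤ φ (1 + l) (3 * (1 + l)) constant (λ g → _ , λ _ → refl)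
      (bound zero ∷ bound (suc zero) ∷ bound (suc (suc zero)) ∷ [])
      (proj₁ denominator>0) (proj₁ (proj₂ denominator>0)) ℕ.≤-refl

  -- A choice of representative that depends only on the coset.
  pick : Subset order → Carrier
  pick C with nonempty? C
  ... | yes (x , _) = element x
  ... | no _        = ε

  ≈-pick : ∀ i x → x ≈[ i ] pick (coset i x)
  ≈-pick i x with nonempty? (coset i x)
  ... | yes (y , y∈) = ∈-coset⁻ i x y∈
  ... | no empty     = contradiction (index x , index∈coset i x) empty

  onVertices : (Fin 3 → Subset order → Bool) → Cochain 1
  onVertices h σ with nonempty? (support σ)
  ... | yes (v , _) = h (proj₁ (vertex v)) (proj₂ (vertex v))
  ... | no _        = false

  onVertices-corner : ∀ h x i → onVertices h (F x (corner i)) ≡ h i (coset i x)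
  onVertices-corner h x i with nonempty? (support (F x (corner i)))
  ... | no empty = contradiction (pt x i , ∈-F⁺ x (corner i) (x∈⁅x⁆ i)) empty
  ... | yes (v , v∈) with ∈-F⁻ x (corner i) v∈
  ...   | j , j∈ , refl with refl ← x∈⁅y⁆⇒x≡y i j∈ = cong (λ u → h (proj₁ u) (proj₂ u)) (vertex-pt x i)

  representative : Fin 3 → Carrier → Carrier
  representative i x = pick (coset i x)

  module Filled (presents : Presents) {l} (short : ∀ g → ShortWord l g) {D} (isDehn : IsDehn D) (φ : Cochain 2) where

    e : Fin 3 → Fin 3 → Carrier → Bool
    e i j g = side (φ ∘ F g) i j

    t : Carrier → Bool
    t g = d φ (F g chamber)

    e-invariant : ∀ i j g {k} → Member (K i) k → Member (K j) k → e i j (g ∙ k) ≡ e i j g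
    e-invariant i j g {k} k∈Kᵢ k∈Kⱼ = side-cong i j λ i≢j → cong φ (F-cong (edge i j i≢j) same)
      where
      same : ∀ {m} → m ∈ˢ ⁅ i ⁆ ∪ ⁅ j ⁆ → g ∙ k ≈[ m ] g
      same m∈ with x∈p∪q⁻ ⁅ i ⁆ ⁅ j ⁆ m∈
      ... | inj₁ m∈i with refl ← x∈⁅y⁆⇒x≡y i m∈i = ≈-sym i (≈-∙ i g k∈Kᵢ)
      ... | inj₂ m∈j with refl ← x∈⁅y⁆⇒x≡y j m∈j = ≈-sym j (≈-∙ j g k∈Kⱼ)

    triangle-bound : ∀ i j g → ⟦ e i j g xor (e zero i g xor e zero j g) ⟧ ℕ.≤ ⟦ t g ⟧
    triangle-bound i j g = subst (λ b → ⟦ e i j g xor (e zero i g xor e zero j g) ⟧ ℕ.≤ ⟦ b ⟧)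
      (sym (d-F φ g chamber)) (side-triangle (φ ∘ F g) i j)

    open Filling G K e t
    open Bounds e-invariant triangle-bound
    open Cone short

    M c : ℕ
    M = 2 * (1 + l) + 1
    c = 5 + D M * 6

    -- The value may depend only on the coset `C`, so the path is spelled by the word of a canonical
    -- representative of `g⁻¹C`. The paths used at `g` are thus the translates by `g` of those used
    -- at ε.
    coneCochain : Carrier → Cochain 1
    coneCochain g = onVertices λ i C → cone g i (representative i (g ⁻¹ ∙ pick C))

    coneCochain-corner : ∀ g x i → coneCochain g (F (g ∙ x) (corner i)) ≡ cone g i (representative i x)
    coneCochain-corner g x i = trans (onVertices-corner _ (g ∙ x) i) (cong (cone g i ∘ pick) (coset-cong i
      (subst (g ⁻¹ ∙ pick (coset i (g ∙ x)) ≈[ i ]_) (x⁻¹∙[x∙y]≡y g x)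
        (≈-sym i (≈-translate i (g ⁻¹) (≈-pick i (g ∙ x)))))))

    -- A chamber has a single face with three vertices, so the inner sum of `mass-orbit` has one
    -- term.
    τ≡ : τ ≡ stabiliserOrder * mass (d φ)
    τ≡ = sym (trans (mass-orbit (d φ)) (∑-cong elements λ g → ℕ.+-identityʳ _))

    bound : ∀ i j i≢j x → μ (λ g → (φ +ᶜ d (coneCochain g)) (F (g ∙ x) (edge i j i≢j))) ℕ.≤
                          c * (stabiliserOrder * mass (d φ))
    bound i j i≢j x = begin
      μ (λ g → (φ +ᶜ d (coneCochain g)) (F (g ∙ x) (edge i j i≢j)))
        ≡⟨ μ-cong (λ g → cong₂ _xor_ (sym (side-edge (φ ∘ F (g ∙ x))))
             (trans (d-F (coneCochain g) (g ∙ x) (edge i j i≢j))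
             (trans (d-edge (coneCochain g ∘ F (g ∙ x)) i j i≢j)
                    (cong₂ _xor_ (coneCochain-corner g x i) (coneCochain-corner g x j))))) ⟩
      μ (λ g → e i j (g ∙ x) xor (cone g i (representative i x) xor cone g j (representative j x)))
        ≤⟨ cone-bound presents isDehn i j x _ _ (≈-sym i (≈-pick i x)) (≈-pick j x) ⟩
      c * τ
        ≡⟨ cong (c *_) τ≡ ⟩
      c * (stabiliserOrder * mass (d φ)) ∎
      where
      open ℕ.≤-Reasoning
      side-edge : ∀ h → side h i j ≡ h (edge i j i≢j)
      side-edge h with i Fin.≟ j
      ... | yes i≡j = contradiction i≡j i≢j
      ... | no _    = refl

    distance : ∀ {m} → IsDistanceToB φ m → m ≤ fromℕ (1 + c) ℚ.* ∥ d φ ∥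
    distance = distance-≤ φ c (1 + c) (d ∘ coneCochain) (λ g → coneCochain g , λ _ → refl)
      (bound zero (suc zero) (λ ()) ∷ bound zero (suc (suc zero)) (λ ()) ∷
       bound (suc zero) (suc (suc zero)) (λ ()) ∷ [])
      (proj₁ (proj₂ denominator>0)) (proj₂ (proj₂ denominator>0)) (begin
        -- The three edges of a chamber cancel against the ratio of 3 C 2 = 3 to 3 C 3 = 1. The
        -- remaining `c` is rounded up to `6 + D M * 6`, which is three times 2 + 2 `D M`.
        3 * c * (1 * T)     ≡⟨ solve 2 (λ c T → con 3 :* c :* (con 1 :* T) := c :* (con 3 :* T)) refl c T ⟩
        c * (3 * T)         ≤⟨ ℕ.*-monoˡ-≤ (3 * T) (ℕ.n≤1+n c) ⟩
        (1 + c) * (3 * T)   ∎)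
      where
      open ℕ.≤-Reasoning
      open +-*-Solver
      T = length (faces 3)

-- Rational arithmetic and the final bounds

toℚᵘ-fromℕ : ∀ a → ℚ.toℚᵘ (fromℕ a) ℚᵘ.≃ ℚᵘ.mkℚᵘ (ℤ.+ a) 0
toℚᵘ-fromℕ a = ℚ.toℚᵘ-fromℚᵘ (ℚᵘ.mkℚᵘ (ℤ.+ a) 0)

fromℕ-+ : ∀ a b → fromℕ a ℚ.+ fromℕ b ≡ fromℕ (a + b)
fromℕ-+ a b = ℚ.toℚᵘ-injective (begin-equality
  ℚ.toℚᵘ (fromℕ a ℚ.+ fromℕ b)                   ≃⟨ ℚ.toℚᵘ-homo-+ (fromℕ a) (fromℕ b) ⟩
  ℚ.toℚᵘ (fromℕ a) ℚᵘ.+ ℚ.toℚᵘ (fromℕ b)         ≃⟨ ℚᵘ.+-cong (toℚᵘ-fromℕ a) (toℚᵘ-fromℕ b) ⟩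
  ℚᵘ.mkℚᵘ (ℤ.+ a) 0 ℚᵘ.+ ℚᵘ.mkℚᵘ (ℤ.+ b) 0
    ≃⟨ ℚᵘ.*≡* (cong (ℤ._* ℤ.+ 1) (cong₂ ℤ._+_ (ℤ.*-identityʳ (ℤ.+ a)) (ℤ.*-identityʳ (ℤ.+ b)))) ⟩
  ℚᵘ.mkℚᵘ (ℤ.+ (a + b)) 0                        ≃⟨ toℚᵘ-fromℕ (a + b) ⟨
  ℚ.toℚᵘ (fromℕ (a + b))                         ∎)
  where open ℚᵘ.≤-Reasoning

fromℕ-* : ∀ a b → fromℕ a ℚ.* fromℕ b ≡ fromℕ (a * b)
fromℕ-* a b = ℚ.toℚᵘ-injective (begin-equality
  ℚ.toℚᵘ (fromℕ a ℚ.* fromℕ b)                   ≃⟨ ℚ.toℚᵘ-homo-* (fromℕ a) (fromℕ b) ⟩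
  ℚ.toℚᵘ (fromℕ a) ℚᵘ.* ℚ.toℚᵘ (fromℕ b)         ≃⟨ ℚᵘ.*-cong (toℚᵘ-fromℕ a) (toℚᵘ-fromℕ b) ⟩
  ℚᵘ.mkℚᵘ (ℤ.+ a) 0 ℚᵘ.* ℚᵘ.mkℚᵘ (ℤ.+ b) 0       ≃⟨ ℚᵘ.*≡* (cong (ℤ._* ℤ.+ 1) (sym (ℤ.pos-* a b))) ⟩
  ℚᵘ.mkℚᵘ (ℤ.+ (a * b)) 0                        ≃⟨ toℚᵘ-fromℕ (a * b) ⟨
  ℚ.toℚᵘ (fromℕ (a * b))                         ∎)
  where open ℚᵘ.≤-Reasoning

1/n*n≡1 : ∀ n → ℤ.+ 1 / suc n ℚ.* fromℕ (suc n) ≡ 1ℚ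
1/n*n≡1 n = ℚ.toℚᵘ-injective (begin-equality
  ℚ.toℚᵘ (ℤ.+ 1 / suc n ℚ.* fromℕ (suc n))              ≃⟨ ℚ.toℚᵘ-homo-* (ℤ.+ 1 / suc n) (fromℕ (suc n)) ⟩
  ℚ.toℚᵘ (ℤ.+ 1 / suc n) ℚᵘ.* ℚ.toℚᵘ (fromℕ (suc n))
    ≃⟨ ℚᵘ.*-cong (ℚ.toℚᵘ-fromℚᵘ (ℚᵘ.mkℚᵘ (ℤ.+ 1) n)) (toℚᵘ-fromℕ (suc n)) ⟩
  ℚᵘ.mkℚᵘ (ℤ.+ 1) n ℚᵘ.* ℚᵘ.mkℚᵘ (ℤ.+ suc n) 0
    ≃⟨ ℚᵘ.*≡* (trans (ℤ.*-identityʳ (ℤ.+ 1 ℤ.* ℤ.+ suc n))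
                      (cong (λ m → ℤ.+ 1 ℤ.* ℤ.+ m) (sym (ℕ.*-identityʳ (suc n))))) ⟩
  ℚᵘ.1ℚᵘ                                                ∎)
  where open ℚᵘ.≤-Reasoning

-- 2 + 2y: a loop of area D bounds at most 6D triangles, and the cone over an edge needs 5 more.
fillingPolynomial : Poly
fillingPolynomial = (fromℕ 2 ∷ fromℕ 2 ∷ []) ∷ []

3*eval-fillingPolynomial : ∀ x D → fromℕ 3 ℚ.* eval fillingPolynomial x (fromℕ D) ≡ fromℕ (6 + D * 6)
3*eval-fillingPolynomial x D = begin
  fromℕ 3 ℚ.* (fromℕ 2 ℚ.+ y ℚ.* (fromℕ 2 ℚ.+ y ℚ.* 0ℚ) ℚ.+ x ℚ.* 0ℚ)
    ≡⟨ cong₂ (λ p q → fromℕ 3 ℚ.* (fromℕ 2 ℚ.+ y ℚ.* (fromℕ 2 ℚ.+ p) ℚ.+ q)) (ℚ.*-zeroʳ y) (ℚ.*-zeroʳ x) ⟩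
  fromℕ 3 ℚ.* (fromℕ 2 ℚ.+ y ℚ.* fromℕ 2 ℚ.+ 0ℚ)
    ≡⟨ cong (fromℕ 3 ℚ.*_) (ℚ.+-identityʳ (fromℕ 2 ℚ.+ y ℚ.* fromℕ 2)) ⟩
  fromℕ 3 ℚ.* (fromℕ 2 ℚ.+ y ℚ.* fromℕ 2)
    ≡⟨ cong (λ p → fromℕ 3 ℚ.* (fromℕ 2 ℚ.+ p)) (fromℕ-* D 2) ⟩
  fromℕ 3 ℚ.* (fromℕ 2 ℚ.+ fromℕ (D * 2))
    ≡⟨ cong (fromℕ 3 ℚ.*_) (fromℕ-+ 2 (D * 2)) ⟩
  fromℕ 3 ℚ.* fromℕ (2 + D * 2)
    ≡⟨ fromℕ-* 3 (2 + D * 2) ⟩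
  fromℕ (3 * (2 + D * 2))
    ≡⟨ cong fromℕ (solve 1 (λ D → con 3 :* (con 2 :+ D :* con 2) := con 6 :+ D :* con 6) refl D) ⟩
  fromℕ (6 + D * 6) ∎
  where
  open ≡-Reasoning
  open +-*-Solver
  y = fromℕ D

theorem1p18 :
  ∃ λ (p : Poly) →
  ∀ (G : FiniteGroup) (K : Fin 3 → Subgroup G) →
  let open CosetComplex G K
      open Cohomology complex 2
      open SubgroupPresentation G K
  in
  TransitiveOn 2 →
  Presents →
  ∀ (l : ℕ) → IsMaxLength l →
  let N₀′ = 1 ℕ.+ l
      M   = 2 ℕ.* N₀′ ℕ.+ 1
  in
  (∀ e → IsExp 0 e → ℤ.+ 1 / (3 ℕ.* N₀′) ≤ e)
  ×
  (∀ (Dehn : ℕ → ℕ) → IsDehn Dehn →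
    let q = fromℕ 3 ℚ.* eval p (fromℕ M) (fromℕ (Dehn M)) in
    Σ (ℚ.Positive q) λ q>0 →
    ∀ e → IsExp 1 e → (1/ q) {{pos⇒nonZero q {{q>0}}}} ≤ e)
theorem1p18 = fillingPolynomial , λ G K transitive presents l maxLength →
  let open CosetComplex G K
      open Weights complex 2
      open Expansion G K transitive
      N₀′ = 1 + l
      M   = 2 * N₀′ + 1
      -- The inequality is decidable, so words that exist only under double negation may be used to
      -- prove it.
      stable : ∀ {c e} → ((∀ g → Words.ShortWord G K l g) → c ≤ e) → c ≤ e
      stable {c} {e} bound = decidable-stable (c ℚ.≤? e) λ ¬bound →
        Words.shortWords G K presents maxLength (¬bound ∘ bound)
  in
  (λ e isExp → stable λ short →
    expansion-≥ (3 * N₀′) {{ℚ.normalize-nonNeg 1 (3 * N₀′)}} (1/n*n≡1 (ℕ.pred (3 * N₀′)))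
      (Connectivity.distance short) e isExp) ,
  λ Dehn isDehn →
    let q = fromℕ 3 ℚ.* eval fillingPolynomial (fromℕ M) (fromℕ (Dehn M))
        q≡ = 3*eval-fillingPolynomial (fromℕ M) (Dehn M)
        -- The constant term 6 keeps `q` positive even where the Dehn function vanishes.
        q>0 = subst ℚ.Positive (sym q≡) (ℚ.normalize-pos (6 + Dehn M * 6) 1)
    in
    q>0 , λ e isExp → stable λ short →
      expansion-≥ (6 + Dehn M * 6)
        {{1/-nonNeg q {{ℚ.pos⇒nonNeg q {{q>0}}}} {{pos⇒nonZero q {{q>0}}}}}}
        (subst (λ k → (1/ q) {{pos⇒nonZero q {{q>0}}}} ℚ.* k ≡ 1ℚ) q≡ (ℚ.*-inverseˡ q {{pos⇒nonZero q {{q>0}}}}))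
        (Filled.distance presents short isDehn) e isExp
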